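{- The following $m$-equivalences hold: $\{123,1112\}\sim\{132,1121\}$ and $\{123,1211\}\sim\{213,1211\}$.
   Context: A (finite, reduced) multiset is $S=1^{a_1}2^{a_2}\cdots k^{a_k}$ with $k\ge 1$ and all $a_i\ge 1$, meaning that $i$ occurs with multiplicity $a_i$. A multipermutation of $S$ is a word having exactly $a_i$ occurrences of each letter $i\in[k]=\{1,\dots,k\}$ and no other letters. A word $\pi=\pi_1\cdots\pi_n$ contains a pattern (word) $\rho=\rho_1\cdots\rho_\ell$ if there are indices $i(1)<\cdots<i(\ell)$ such that for all $a,b\in[\ell]$: $\pi_{i(a)}<\pi_{i(b)}$ iff $\rho_a<\rho_b$, and $\pi_{i(a)}>\pi_{i(b)}$ iff $\rho_a>\rho_b$; otherwise $\pi$ avoids $\rho$. For a set $P$ of patterns, $\mathrm{av}(S;P)$ is the number of multipermutations of $S$ that avoid every pattern in $P$. Two sets of patterns $P,Q$ are $m$-equivalent, written here $P\sim Q$, if $\mathrm{av}(S;P)=\mathrm{av}(S;Q)$ for every multiset $S$. -}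

module Defs where

open import Data.Nat using (ℕ; zero; suc; _+_; _≤_; _<_; _>_; _≤?_; _<?_; _≟_)
open import Data.Nat.Properties
  using (suc-injective; +-suc)
open import Data.Fin as Fin using (Fin; toℕ; fromℕ<)
import Data.Fin.Properties as Fin
open import Data.List
  using (List; []; _∷_; length; filter; lookup; map; tabulate; upTo; cartesianProductWith)
open import Data.Nat.ListAction using (sum)
open import Data.List.Properties using (∷-injective; filter-accept; filter-reject)
open import Data.List.Membership.Propositional using (_∈_)
open import Data.List.Membership.Propositional.Properties
  using (∈-map⁺; ∈-upTo⁺; ∈-cartesianProductWith⁺; ∈-filter⁺; ∈-filter⁻)
open import Data.List.Relation.Unary.All as All using (All; []; _∷_)
open import Data.List.Relation.Unary.Any using (here)
open import Data.List.Relation.Unary.Unique.Propositional using (Unique)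
import Data.List.Relation.Unary.Unique.Propositional.Properties as Unique
open import Data.List.Relation.Unary.AllPairs using ([]; _∷_)
open import Data.Vec as Vec using (Vec; []; _∷_)
open import Data.Product using (∃; ∃-syntax; _×_; _,_; proj₁; proj₂)
open import Function using (_∘_; _⇔_; mk⇔; Equivalence)
open import Relation.Nullary using (Dec; ¬_; ¬?; _×-dec_; _→-dec_)
open import Relation.Nullary.Decidable using (map′)
open import Relation.Unary using (Decidable)
open import Relation.Binary.PropositionalEquality

-- The multiset 1^{a₁} 2^{a₂} ⋯ k^{aₖ}.  The multiplicity of the letter i + 1
-- is `mult i`, since Fin k is {0,…,k-1}.
record Multiset : Set where
  field
    k      : ℕ
    mult   : Fin k → ℕ
    k≥1    : 1 ≤ k
    mult≥1 : ∀ i → 1 ≤ mult i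

  size : ℕ
  size = sum (tabulate mult)

open Multiset

Word : Set
Word = List ℕ

occurrences : ℕ → Word → ℕ
occurrences x π = length (filter (x ≟_) π)

IsMultipermutation : Multiset → Word → Set
IsMultipermutation S π =
  (∀ (i : Fin (k S)) → occurrences (suc (toℕ i)) π ≡ mult S i) ×
  All (λ x → 1 ≤ x × x ≤ k S) π

IsOccurrence : (π ρ : Word) → Vec (Fin (length π)) (length ρ) → Set
IsOccurrence π ρ ι =
  (∀ a b → a Fin.< b → Vec.lookup ι a Fin.< Vec.lookup ι b) ×
  (∀ a b →
    (lookup π (Vec.lookup ι a) < lookup π (Vec.lookup ι b) ⇔ lookup ρ a < lookup ρ b) ×
    (lookup π (Vec.lookup ι a) > lookup π (Vec.lookup ι b) ⇔ lookup ρ a > lookup ρ b))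

Contains : Word → Word → Set
Contains π ρ = ∃[ ι ] IsOccurrence π ρ ι

Avoids : Word → Word → Set
Avoids π ρ = ¬ Contains π ρ

AvoidsAll : List Word → Word → Set
AvoidsAll P π = All (Avoids π) P

_⇔?_ : ∀ {A B : Set} → Dec A → Dec B → Dec (A ⇔ B)
a? ⇔? b? = map′ (λ (f , g) → mk⇔ f g)
                (λ e → Equivalence.to e , Equivalence.from e)
                ((a? →-dec b?) ×-dec (b? →-dec a?))

anyVec? : ∀ {n} ℓ {Q : Vec (Fin n) ℓ → Set} → Decidable Q → Dec (∃ Q)
anyVec? zero    Q? = map′ (λ q → [] , q) (λ { ([] , q) → q }) (Q? [])
anyVec? (suc ℓ) Q? =
  map′ (λ (x , xs , q) → x ∷ xs , q) (λ { (x ∷ xs , q) → x , xs , q })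
       (Fin.any? λ x → anyVec? ℓ λ xs → Q? (x ∷ xs))

isMultipermutation? : ∀ S → Decidable (IsMultipermutation S)
isMultipermutation? S π =
  Fin.all? (λ i → occurrences (suc (toℕ i)) π ≟ mult S i) ×-dec
  All.all? (λ x → (1 ≤? x) ×-dec (x ≤? k S)) π

isOccurrence? : ∀ π ρ → Decidable (IsOccurrence π ρ)
isOccurrence? π ρ ι =
  Fin.all? (λ a → Fin.all? λ b → (a Fin.<? b) →-dec (Vec.lookup ι a Fin.<? Vec.lookup ι b)) ×-dec
  Fin.all? (λ a → Fin.all? λ b →
    ((lookup π (Vec.lookup ι a) <? lookup π (Vec.lookup ι b)) ⇔? (lookup ρ a <? lookup ρ b)) ×-dec
    ((lookup π (Vec.lookup ι b) <? lookup π (Vec.lookup ι a)) ⇔? (lookup ρ b <? lookup ρ a)))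

contains? : ∀ π ρ → Dec (Contains π ρ)
contains? π ρ = anyVec? (length ρ) (isOccurrence? π ρ)

avoidsAll? : ∀ P → Decidable (AvoidsAll P)
avoidsAll? P π = All.all? (λ ρ → ¬? (contains? π ρ)) P

words : (m n : ℕ) → List Word
words m zero    = [] ∷ []
words m (suc n) = cartesianProductWith _∷_ (map suc (upTo m)) (words m n)

-- `∈-multipermutations` and `multipermutations-unique` below show that this
-- lists every multipermutation of S exactly once.
multipermutations : Multiset → List Word
multipermutations S = filter (isMultipermutation? S) (words (k S) (size S))

av : Multiset → List Word → ℕ
av S P = length (filter (avoidsAll? P) (multipermutations S))

infix 4 _∼_

_∼_ : List Word → List Word → Set
P ∼ Q = ∀ S → av S P ≡ av S Q

words-unique : ∀ m n → Unique (words m n)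
words-unique m zero    = [] ∷ []
words-unique m (suc n) =
  Unique.cartesianProductWith⁺ _∷_ ∷-injective
    (Unique.map⁺ suc-injective (Unique.upTo⁺ m)) (words-unique m n)

∈-words : ∀ {m} π → All (λ x → 1 ≤ x × x ≤ m) π → π ∈ words m (length π)
∈-words []          []                    = here refl
∈-words (suc x ∷ π) ((_ , x<m) ∷ letters) =
  ∈-cartesianProductWith⁺ _∷_ (∈-map⁺ suc (∈-upTo⁺ x<m)) (∈-words π letters)

sum-zero : ∀ m (f : Fin m → ℕ) → (∀ i → f i ≡ 0) → sum (tabulate f) ≡ 0
sum-zero zero    f f≡0 = refl
sum-zero (suc m) f f≡0 = cong₂ _+_ (f≡0 Fin.zero) (sum-zero m (f ∘ Fin.suc) (f≡0 ∘ Fin.suc))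

sum-cong : ∀ m {f g : Fin m → ℕ} → (∀ i → f i ≡ g i) → sum (tabulate f) ≡ sum (tabulate g)
sum-cong zero    f≡g = refl
sum-cong (suc m) f≡g = cong₂ _+_ (f≡g Fin.zero) (sum-cong m (f≡g ∘ Fin.suc))

sum-bump : ∀ m (f g : Fin m → ℕ) j → f j ≡ suc (g j) → (∀ i → i ≢ j → f i ≡ g i) →
           sum (tabulate f) ≡ suc (sum (tabulate g))
sum-bump (suc m) f g Fin.zero    fj f≡g =
  cong₂ _+_ fj (sum-cong m λ i → f≡g (Fin.suc i) λ ())
sum-bump (suc m) f g (Fin.suc j) fj f≡g =
  trans (cong₂ _+_ (f≡g Fin.zero λ ())
                   (sum-bump m (f ∘ Fin.suc) (g ∘ Fin.suc) j fj
                      λ i i≢j → f≡g (Fin.suc i) (i≢j ∘ Fin.suc-injective)))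
        (+-suc _ _)

sum-occurrences : ∀ m π → All (λ x → 1 ≤ x × x ≤ m) π →
                  sum (tabulate {n = m} λ i → occurrences (suc (toℕ i)) π) ≡ length π
sum-occurrences m []          []                    = sum-zero m _ λ _ → refl
sum-occurrences m (suc x ∷ π) ((_ , x<m) ∷ letters) =
  trans (sum-bump m _ _ (fromℕ< x<m)
           (cong length (filter-accept (suc (toℕ (fromℕ< x<m)) ≟_) {x = suc x} {xs = π} (cong suc (Fin.toℕ-fromℕ< x<m))))
           (λ i i≢x → cong length (filter-reject (suc (toℕ i) ≟_) {x = suc x} {xs = π} λ eq →
              i≢x (Fin.toℕ-injective (trans (suc-injective eq) (sym (Fin.toℕ-fromℕ< x<m)))))))
        (cong suc (sum-occurrences m π letters))

∈-multipermutations : ∀ S π → π ∈ multipermutations S ⇔ IsMultipermutation S π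
∈-multipermutations S π = mk⇔
  (proj₂ ∘ ∈-filter⁻ (isMultipermutation? S) {xs = words (k S) (size S)})
  (λ { p@(occ , letters) → ∈-filter⁺ (isMultipermutation? S)
         (subst (λ n → π ∈ words (k S) n)
                (trans (sym (sum-occurrences (k S) π letters)) (sum-cong (k S) occ))
                (∈-words π letters))
         p })

multipermutations-unique : ∀ S → Unique (multipermutations S)
multipermutations-unique S =
  Unique.filter⁺ (isMultipermutation? S) (words-unique (k S) (size S))

module Submission where

-- Each set of patterns gives a generating tree: an avoider arises from the one without the
-- smallest letter (the other letters lowered by one) by inserting the copies of that letter.
-- A copy may only be put at an active cut: for 123 and 132 one before which the word is monotone
-- (reading from the right), for 213 one that separates smaller from larger letters. The pattern
-- with a repeated letter leaves only two copies free: the others are at the end of the word or next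
-- to one of these. So children correspond to nested pairs of active cuts (to single cuts if there
-- is only one copy). The number of active cuts of a child depends only on where the pair lies
-- among the active cuts of its parent, and for both sets of patterns the numbers of active cuts
-- of the children of a word form the same multiset, which depends only on the number of copies
-- and on the number of active cuts of the word.

-- The children of words of equal degree are not matched one by one. That their degrees form the
-- same multiset is expressed by test functions: the sum of any `f : ℕ → ℕ` over the degrees of the
-- children of a word of degree `n` is `step c f n`. The equivalence thus reduces to the equality of
-- two operators `step`, a rearrangement of a double sum over nested pairs of cuts; the constant
-- function 1 then counts the avoiders. The three-letter patterns have a single smallest letter, so
-- every new copy is tested on its own. The four-letter patterns contain theirs three times, so they
-- do not constrain one or two new copies, and once two are placed every further copy has only one
-- place. For 123 and 132 the active cuts form an initial run, so the length of a prefix tells how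
-- many of them precede its end. For 213 there may be gaps, and only the emptiness of a block can be
-- read off; this suffices because the degrees there depend on the number of remaining cuts instead.

open import Defs
open import Data.Bool using (true; false)
open import Data.Fin as Fin using (Fin; toℕ)
open import Data.List
  using (List; []; _∷_; _++_; map; length; lookup; tabulate; filter; drop; replicate; reverse; concatMap)
open import Data.List.Properties hiding (sum-++)
open import Data.List.Membership.Propositional using (_∈_; find; lose)
open import Data.List.Membership.Propositional.Properties
  using (∈-map⁺; ∈-map⁻; ∈-concatMap⁺; ∈-concatMap⁻; ∈-++⁺ˡ; ∈-++⁺ʳ; ∈-filter⁺; ∈-filter⁻)
open import Data.List.Membership.Propositional.Properties.WithK using (unique∧set⇒bag)
open import Data.List.Relation.Binary.BagAndSetEquality using (∼bag⇒↭)
open import Data.List.Relation.Binary.Permutation.Propositional using (↭-sym)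
open import Data.List.Relation.Binary.Permutation.Propositional.Properties
  using (↭-length; filter-↭; ↭-reverse; All-resp-↭)
open import Data.List.Relation.Binary.Sublist.Propositional
  using (_⊆_; []; _∷_; _∷ʳ_; ⊆-trans; minimum; from∈; to∈)
import Data.List.Relation.Binary.Sublist.Propositional.Properties as Sub
open import Data.List.Relation.Unary.All as All using (All; []; _∷_)
import Data.List.Relation.Unary.All.Properties as All
open import Data.List.Relation.Unary.AllPairs as AllPairs using (AllPairs; []; _∷_)
import Data.List.Relation.Unary.AllPairs.Properties as AllPairs
open import Data.List.Relation.Unary.Any using (here; there)
open import Data.List.Relation.Unary.Unique.Propositional using (Unique)
import Data.List.Relation.Unary.Unique.Propositional.Properties as Unique
open import Data.Nat
  using (ℕ; zero; suc; pred; _+_; _≤_; _<_; _>_; _≥_; z≤n; s≤s; _≡ᵇ_; _≟_; _≤?_; >-nonZero)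
open import Data.Nat.ListAction using (sum)
open import Data.Nat.ListAction.Properties using (sum-++)
open import Data.Nat.Properties hiding (_≟_; _≤?_)
open import Data.Nat.Solver using (module +-*-Solver)
open import Data.Product using (∃-syntax; _×_; _,_; proj₁; proj₂; map₁)
open import Data.Sum using (inj₁; inj₂)
open import Data.Unit using (⊤; tt)
open import Data.Vec as Vec using (Vec)
import Data.Vec.Properties as Vec
open import Function using (_∘_; _⇔_; mk⇔; Equivalence; id)
open import Relation.Binary.Definitions using (tri<; tri≈; tri>)
open import Relation.Binary.PropositionalEquality
open import Relation.Nullary using (¬_; Dec; yes; no; contradiction)
open import Relation.Nullary.Decidable using (decidable-stable)

open Equivalence

-- Occurrences as sublists

Iso : ∀ {n} (f g : Fin n → ℕ) → Set
Iso f g = ∀ a b → (f a < f b ⇔ g a < g b) × (f a > f b ⇔ g a > g b)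

lookup∷⊆drop : ∀ {π σ : Word} m (i : Fin (length π)) → m ≤ toℕ i →
               σ ⊆ drop (suc (toℕ i)) π → lookup π i ∷ σ ⊆ drop m π
lookup∷⊆drop {x ∷ π} zero    Fin.zero    m≤i σ⊆π = refl ∷ σ⊆π
lookup∷⊆drop {x ∷ π} zero    (Fin.suc i) m≤i σ⊆π = x ∷ʳ lookup∷⊆drop zero i z≤n σ⊆π
lookup∷⊆drop {x ∷ π} (suc m) (Fin.suc i) (s≤s m≤i) σ⊆π = lookup∷⊆drop m i m≤i σ⊆π

tabulate-lookup⊆ : ∀ {n} m (π : Word) (f : Fin n → Fin (length π)) →
                   (∀ a b → a Fin.< b → f a Fin.< f b) → (∀ a → m ≤ toℕ (f a)) →
                   tabulate (lookup π ∘ f) ⊆ drop m π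
tabulate-lookup⊆ {zero}  m π f mono m≤f = minimum _
tabulate-lookup⊆ {suc n} m π f mono m≤f =
  lookup∷⊆drop m (f Fin.zero) (m≤f Fin.zero)
    (tabulate-lookup⊆ _ π (f ∘ Fin.suc) (λ a b a<b → mono _ _ (s≤s a<b))
                      (λ a → mono _ _ (s≤s z≤n)))

contains⇒⊆ : ∀ {π} ρ → Contains π ρ → ∃[ f ] tabulate {n = length ρ} f ⊆ π × Iso f (lookup ρ)
contains⇒⊆ {π} ρ (ι , mono , iso) =
  lookup π ∘ Vec.lookup ι , tabulate-lookup⊆ 0 π (Vec.lookup ι) mono (λ _ → z≤n) , iso

module _ (g : ℕ → ℕ) where

  index : ∀ {ρ π : Word} → map g ρ ⊆ π → Fin (length ρ) → Fin (length π)
  index {x ∷ ρ} (y ∷ʳ s)   a           = Fin.suc (index s a)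
  index {x ∷ ρ} (refl ∷ s) Fin.zero    = Fin.zero
  index {x ∷ ρ} (refl ∷ s) (Fin.suc a) = Fin.suc (index s a)

  lookup-index : ∀ {ρ π : Word} (s : map g ρ ⊆ π) a → lookup π (index s a) ≡ g (lookup ρ a)
  lookup-index {x ∷ ρ} (y ∷ʳ s)   a           = lookup-index s a
  lookup-index {x ∷ ρ} (refl ∷ s) Fin.zero    = refl
  lookup-index {x ∷ ρ} (refl ∷ s) (Fin.suc a) = lookup-index s a

  index-mono : ∀ {ρ π : Word} (s : map g ρ ⊆ π) a b → a Fin.< b → index s a Fin.< index s b
  index-mono {x ∷ ρ} (y ∷ʳ s)   a           b           a<b       = s≤s (index-mono s a b a<b)
  index-mono {x ∷ ρ} (refl ∷ s) Fin.zero    (Fin.suc b) a<b       = s≤s z≤n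
  index-mono {x ∷ ρ} (refl ∷ s) (Fin.suc a) (Fin.suc b) (s≤s a<b) = s≤s (index-mono s a b a<b)

  module _ (g-suc : ∀ n → g n < g (suc n)) where

    g-mono : ∀ {m n} → m < n → g m < g n
    g-mono {m} {suc n} (s≤s m≤n) with m≤n⇒m<n∨m≡n m≤n
    ... | inj₁ m<n  = <-trans (g-mono m<n) (g-suc n)
    ... | inj₂ refl = g-suc m

    g-mono⁻ : ∀ {m n} → g m < g n → m < n
    g-mono⁻ {m} {n} gm<gn with <-cmp m n
    ... | tri< m<n _ _    = m<n
    ... | tri≈ _ refl _   = contradiction gm<gn (<-irrefl refl)
    ... | tri> _ _ n<m    = contradiction gm<gn (<-asym (g-mono n<m))

    ⊆⇒contains : ∀ {π} ρ → map g ρ ⊆ π → Contains π ρ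
    ⊆⇒contains {π} ρ s = Vec.tabulate (index s) , mono , λ a b → iso a b , iso b a
      where
      at : ∀ a → lookup π (Vec.lookup (Vec.tabulate (index s)) a) ≡ g (lookup ρ a)
      at a = trans (cong (lookup π) (Vec.lookup∘tabulate (index s) a)) (lookup-index s a)

      mono : ∀ a b → a Fin.< b →
             Vec.lookup (Vec.tabulate (index s)) a Fin.< Vec.lookup (Vec.tabulate (index s)) b
      mono a b a<b = subst₂ Fin._<_ (sym (Vec.lookup∘tabulate (index s) a))
                            (sym (Vec.lookup∘tabulate (index s) b)) (index-mono s a b a<b)

      iso : ∀ a b → _ < _ ⇔ lookup ρ a < lookup ρ b
      iso a b = mk⇔ (λ lt → g-mono⁻ (subst₂ _<_ (at a) (at b) lt))
                    (λ lt → subst₂ _<_ (sym (at a)) (sym (at b)) (g-mono lt))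

-- Sends the pattern letters 1, 2, 3 to the decoded forms of `a`, `b`, `c`. The values at 0 and
-- beyond 3 are chosen to keep the function strictly increasing on all of ℕ.
through : ℕ → ℕ → ℕ → ℕ → ℕ
through a b c 0 = 0
through a b c 1 = suc a
through a b c 2 = suc b
through a b c (suc (suc (suc n))) = suc (n + c)

through-suc : ∀ {a b c} → a < b → b < c → ∀ n → through a b c n < through a b c (suc n)
through-suc a<b b<c 0 = s≤s z≤n
through-suc a<b b<c 1 = s≤s a<b
through-suc a<b b<c 2 = s≤s b<c
through-suc a<b b<c (suc (suc (suc n))) = n<1+n _

lift : Word → Word
lift = map suc

⊆-lift⁻ : ∀ {σ v} → σ ⊆ lift v → ∃[ τ ] σ ≡ lift τ × τ ⊆ v
⊆-lift⁻ {v = []}    []         = [] , refl , []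
⊆-lift⁻ {v = x ∷ v} (_ ∷ʳ s)   = let τ , eq , t = ⊆-lift⁻ s in τ , eq , x ∷ʳ t
⊆-lift⁻ {v = x ∷ v} (refl ∷ s) = let τ , eq , t = ⊆-lift⁻ s in x ∷ τ , cong (suc x ∷_) eq , refl ∷ t

-- Words are encoded reversed and with letters from 0: the new smallest letter is 0, and active
-- cuts are found reading from the left.
decode : Word → Word
decode v = lift (reverse v)

⊆-decode⁺ : ∀ {σ v} → σ ⊆ v → decode σ ⊆ decode v
⊆-decode⁺ s = Sub.map⁺ suc (Sub.reverse⁺ s)

⊆-decode⁻ : ∀ {σ} v → σ ⊆ decode v → ∃[ τ ] σ ≡ lift τ × reverse τ ⊆ v
⊆-decode⁻ v s = let τ , eq , t = ⊆-lift⁻ s in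
  τ , eq , subst (reverse τ ⊆_) (reverse-involutive v) (Sub.reverse⁺ t)

⊆⇒contains-decode : ∀ {a b c v} → a < b → b < c → ∀ ρ σ →
                    map (through a b c) ρ ≡ decode σ → σ ⊆ v → Contains (decode v) ρ
⊆⇒contains-decode a<b b<c ρ σ eq s =
  ⊆⇒contains _ (through-suc a<b b<c) ρ (subst (_⊆ _) (sym eq) (⊆-decode⁺ s))

-- F lists the reversed occurrences of the pattern in terms of its letters a < b < c.
Av₃ : (ℕ → ℕ → ℕ → Word) → Word → Set
Av₃ F v = ∀ {a b c} → a < b → b < c → ¬ F a b c ⊆ v

Av₄ : (ℕ → ℕ → Word) → Word → Set
Av₄ F v = ∀ {a b} → a < b → ¬ F a b ⊆ v

-- Avoidance of the six patterns, read in encoded words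

pattern #0 = Fin.zero
pattern #1 = Fin.suc #0
pattern #2 = Fin.suc #1
pattern #3 = Fin.suc #2

-- `Iso` compares by < and > alone; the equality of repeated pattern letters comes back by
-- trichotomy.
Iso⇒≡ : ∀ {n} {f g : Fin n → ℕ} → Iso f g → ∀ a b → g a ≡ g b → f a ≡ f b
Iso⇒≡ {f = f} iso a b eq with <-cmp (f a) (f b)
... | tri< lt _ _  = contradiction (to (proj₁ (iso a b)) lt) (<-irrefl eq)
... | tri≈ _ eq′ _ = eq′
... | tri> _ _ gt  = contradiction (to (proj₂ (iso a b)) gt) (<-irrefl (sym eq))

unreverse₃ : ∀ {x y z} v → x ∷ y ∷ z ∷ [] ⊆ decode v →
             ∃[ a ] ∃[ b ] ∃[ c ] x ≡ suc a × y ≡ suc b × z ≡ suc c × c ∷ b ∷ a ∷ [] ⊆ v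
unreverse₃ v s with ⊆-decode⁻ v s
... | a ∷ b ∷ c ∷ [] , refl , t = a , b , c , refl , refl , refl , t

unreverse₄ : ∀ {x y z w} v → x ∷ y ∷ z ∷ w ∷ [] ⊆ decode v →
             ∃[ a ] ∃[ b ] ∃[ c ] ∃[ d ] x ≡ suc a × y ≡ suc b × z ≡ suc c × w ≡ suc d × d ∷ c ∷ b ∷ a ∷ [] ⊆ v
unreverse₄ v s with ⊆-decode⁻ v s
... | a ∷ b ∷ c ∷ d ∷ [] , refl , t = a , b , c , d , refl , refl , refl , refl , t

F123 F132 F213 : ℕ → ℕ → ℕ → Word
F123 a b c = c ∷ b ∷ a ∷ []
F132 a b c = b ∷ c ∷ a ∷ []
F213 a b c = c ∷ a ∷ b ∷ []

F1112 F1121 F1211 : ℕ → ℕ → Word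
F1112 a b = b ∷ a ∷ a ∷ a ∷ []
F1121 a b = a ∷ b ∷ a ∷ a ∷ []
F1211 a b = a ∷ a ∷ b ∷ a ∷ []

av-123 : ∀ v → Av₃ F123 v ⇔ Avoids (decode v) (1 ∷ 2 ∷ 3 ∷ [])
av-123 v = mk⇔ avoid λ h {a} {b} {c} p q s → h (⊆⇒contains-decode p q _ (F123 a b c) refl s)
  where
  clash : ∀ {x y z} → Av₃ F123 v → x < y → y < z → ¬ x ∷ y ∷ z ∷ [] ⊆ decode v
  clash av x<y y<z s with _ , _ , _ , refl , refl , refl , t ← unreverse₃ v s = av (≤-pred x<y) (≤-pred y<z) t
  avoid : Av₃ F123 v → Avoids (decode v) (1 ∷ 2 ∷ 3 ∷ [])
  avoid av C with f , s , iso ← contains⇒⊆ _ C =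
    clash av (from (proj₁ (iso #0 #1)) ≤-refl) (from (proj₁ (iso #1 #2)) ≤-refl) s

av-132 : ∀ v → Av₃ F132 v ⇔ Avoids (decode v) (1 ∷ 3 ∷ 2 ∷ [])
av-132 v = mk⇔ avoid λ h {a} {b} {c} p q s → h (⊆⇒contains-decode p q _ (F132 a b c) refl s)
  where
  clash : ∀ {x y z} → Av₃ F132 v → x < z → z < y → ¬ x ∷ y ∷ z ∷ [] ⊆ decode v
  clash av x<z z<y s with _ , _ , _ , refl , refl , refl , t ← unreverse₃ v s = av (≤-pred x<z) (≤-pred z<y) t
  avoid : Av₃ F132 v → Avoids (decode v) (1 ∷ 3 ∷ 2 ∷ [])
  avoid av C with f , s , iso ← contains⇒⊆ _ C =
    clash av (from (proj₁ (iso #0 #2)) ≤-refl) (from (proj₁ (iso #2 #1)) ≤-refl) s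

av-213 : ∀ v → Av₃ F213 v ⇔ Avoids (decode v) (2 ∷ 1 ∷ 3 ∷ [])
av-213 v = mk⇔ avoid λ h {a} {b} {c} p q s → h (⊆⇒contains-decode p q _ (F213 a b c) refl s)
  where
  clash : ∀ {x y z} → Av₃ F213 v → y < x → x < z → ¬ x ∷ y ∷ z ∷ [] ⊆ decode v
  clash av y<x x<z s with _ , _ , _ , refl , refl , refl , t ← unreverse₃ v s = av (≤-pred y<x) (≤-pred x<z) t
  avoid : Av₃ F213 v → Avoids (decode v) (2 ∷ 1 ∷ 3 ∷ [])
  avoid av C with f , s , iso ← contains⇒⊆ _ C =
    clash av (from (proj₁ (iso #1 #0)) ≤-refl) (from (proj₁ (iso #0 #2)) ≤-refl) s

av-1112 : ∀ v → Av₄ F1112 v ⇔ Avoids (decode v) (1 ∷ 1 ∷ 1 ∷ 2 ∷ [])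
-- The pattern has no letter 3, so any number above `b` may serve as the third letter of `through`.
av-1112 v = mk⇔ avoid λ h {a} {b} p s → h (⊆⇒contains-decode p (n<1+n b) _ (F1112 a b) refl s)
  where
  clash : ∀ {x y z w} → Av₄ F1112 v → x ≡ y → y ≡ z → z < w → ¬ x ∷ y ∷ z ∷ w ∷ [] ⊆ decode v
  clash av refl refl z<w s with _ , _ , _ , _ , refl , refl , refl , refl , t ← unreverse₄ v s = av (≤-pred z<w) t
  avoid : Av₄ F1112 v → Avoids (decode v) (1 ∷ 1 ∷ 1 ∷ 2 ∷ [])
  avoid av C with f , s , iso ← contains⇒⊆ _ C =
    clash av (Iso⇒≡ iso #0 #1 refl) (Iso⇒≡ iso #1 #2 refl) (from (proj₁ (iso #2 #3)) ≤-refl) s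

av-1121 : ∀ v → Av₄ F1121 v ⇔ Avoids (decode v) (1 ∷ 1 ∷ 2 ∷ 1 ∷ [])
av-1121 v = mk⇔ avoid λ h {a} {b} p s → h (⊆⇒contains-decode p (n<1+n b) _ (F1121 a b) refl s)
  where
  clash : ∀ {x y z w} → Av₄ F1121 v → x ≡ y → y ≡ w → y < z → ¬ x ∷ y ∷ z ∷ w ∷ [] ⊆ decode v
  clash av refl refl y<z s with _ , _ , _ , _ , refl , refl , refl , refl , t ← unreverse₄ v s = av (≤-pred y<z) t
  avoid : Av₄ F1121 v → Avoids (decode v) (1 ∷ 1 ∷ 2 ∷ 1 ∷ [])
  avoid av C with f , s , iso ← contains⇒⊆ _ C =
    clash av (Iso⇒≡ iso #0 #1 refl) (Iso⇒≡ iso #1 #3 refl) (from (proj₁ (iso #1 #2)) ≤-refl) s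

av-1211 : ∀ v → Av₄ F1211 v ⇔ Avoids (decode v) (1 ∷ 2 ∷ 1 ∷ 1 ∷ [])
av-1211 v = mk⇔ avoid λ h {a} {b} p s → h (⊆⇒contains-decode p (n<1+n b) _ (F1211 a b) refl s)
  where
  clash : ∀ {x y z w} → Av₄ F1211 v → x ≡ z → z ≡ w → x < y → ¬ x ∷ y ∷ z ∷ w ∷ [] ⊆ decode v
  clash av refl refl x<y s with _ , _ , _ , _ , refl , refl , refl , refl , t ← unreverse₄ v s = av (≤-pred x<y) t
  avoid : Av₄ F1211 v → Avoids (decode v) (1 ∷ 2 ∷ 1 ∷ 1 ∷ [])
  avoid av C with f , s , iso ← contains⇒⊆ _ C =
    clash av (Iso⇒≡ iso #0 #2 refl) (Iso⇒≡ iso #2 #3 refl) (from (proj₁ (iso #0 #1)) ≤-refl) s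

-- Removing and inserting the smallest letter

zeros : Word → ℕ
zeros []          = 0
zeros (zero ∷ v)  = suc (zeros v)
zeros (suc _ ∷ v) = zeros v

reduce : Word → Word
reduce []          = []
reduce (zero ∷ v)  = reduce v
reduce (suc x ∷ v) = x ∷ reduce v

0^ : ℕ → Word
0^ n = replicate n 0

reduce-++ : ∀ u v → reduce (u ++ v) ≡ reduce u ++ reduce v
reduce-++ []          v = refl
reduce-++ (zero ∷ u)  v = reduce-++ u v
reduce-++ (suc x ∷ u) v = cong (x ∷_) (reduce-++ u v)

reduce-lift++ : ∀ p v → reduce (lift p ++ v) ≡ p ++ reduce v
reduce-lift++ []      v = refl
reduce-lift++ (x ∷ p) v = cong (x ∷_) (reduce-lift++ p v)

reduce-lift : ∀ p → reduce (lift p) ≡ p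
reduce-lift []      = refl
reduce-lift (x ∷ p) = cong (x ∷_) (reduce-lift p)

reduce-0^++ : ∀ n v → reduce (0^ n ++ v) ≡ reduce v
reduce-0^++ zero    v = refl
reduce-0^++ (suc n) v = reduce-0^++ n v

zeros-lift++ : ∀ p v → zeros (lift p ++ v) ≡ zeros v
zeros-lift++ []      v = refl
zeros-lift++ (x ∷ p) v = zeros-lift++ p v

zeros-lift : ∀ p → zeros (lift p) ≡ 0
zeros-lift []      = refl
zeros-lift (x ∷ p) = zeros-lift p

zeros-0^++ : ∀ n v → zeros (0^ n ++ v) ≡ n + zeros v
zeros-0^++ zero    v = refl
zeros-0^++ (suc n) v = cong suc (zeros-0^++ n v)

zeros≡0⇒lift : ∀ v → zeros v ≡ 0 → v ≡ lift (reduce v)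
zeros≡0⇒lift []          eq = refl
zeros≡0⇒lift (suc x ∷ v) eq = cong (suc x ∷_) (zeros≡0⇒lift v eq)

first-zero : ∀ {k} v → zeros v ≡ suc k → ∃[ p ] ∃[ t ] v ≡ lift p ++ 0 ∷ t × zeros t ≡ k
first-zero (zero ∷ v)  eq = [] , v , refl , suc-injective eq
first-zero (suc x ∷ v) eq with p , t , refl , eq′ ← first-zero v eq = x ∷ p , t , refl , eq′

reduce-⊆ : ∀ {σ v} → σ ⊆ v → reduce σ ⊆ reduce v
reduce-⊆ []                    = []
reduce-⊆ (zero ∷ʳ s)           = reduce-⊆ s
reduce-⊆ (suc x ∷ʳ s)          = x ∷ʳ reduce-⊆ s
reduce-⊆ (_∷_ {x = zero} refl s)  = reduce-⊆ s
reduce-⊆ (_∷_ {x = suc x} refl s) = refl ∷ reduce-⊆ s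

zeros-⊆ : ∀ {σ v} → σ ⊆ v → zeros σ ≤ zeros v
zeros-⊆ []                    = z≤n
zeros-⊆ (zero ∷ʳ s)           = m≤n⇒m≤1+n (zeros-⊆ s)
zeros-⊆ (suc x ∷ʳ s)          = zeros-⊆ s
zeros-⊆ (_∷_ {x = zero} refl s)  = s≤s (zeros-⊆ s)
zeros-⊆ (_∷_ {x = suc x} refl s) = zeros-⊆ s

lift-reduce-⊆ : ∀ v → lift (reduce v) ⊆ v
lift-reduce-⊆ []          = []
lift-reduce-⊆ (zero ∷ v)  = 0 ∷ʳ lift-reduce-⊆ v
lift-reduce-⊆ (suc x ∷ v) = refl ∷ lift-reduce-⊆ v

lift-⊆ : ∀ {σ v} → σ ⊆ reduce v → lift σ ⊆ v
lift-⊆ s = ⊆-trans (Sub.map⁺ suc s) (lift-reduce-⊆ _)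

split-⊆ : ∀ σ {x : ℕ} {τ v} → σ ++ x ∷ τ ⊆ v →
          ∃[ s ] ∃[ t ] v ≡ s ++ x ∷ t × σ ⊆ s × τ ⊆ t
split-⊆ []      (y ∷ʳ sub)   = let s , t , eq , a , b = split-⊆ [] sub in
                               y ∷ s , t , cong (y ∷_) eq , y ∷ʳ a , b
split-⊆ []      (refl ∷ sub) = [] , _ , refl , [] , sub
split-⊆ (z ∷ σ) (y ∷ʳ sub)   = let s , t , eq , a , b = split-⊆ (z ∷ σ) sub in
                               y ∷ s , t , cong (y ∷_) eq , y ∷ʳ a , b
split-⊆ (z ∷ σ) (refl ∷ sub) = let s , t , eq , a , b = split-⊆ σ sub in
                               z ∷ s , t , cong (z ∷_) eq , refl ∷ a , b

-- An occurrence of a pattern with a single smallest letter uses at most one 0, so the zeros can be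
-- tested separately; the other zeros are erased from both sides of the cut.
Splits : (Word → Word → Set) → Word → Set
Splits Q []          = ⊤
Splits Q (zero ∷ v)  = Q [] (reduce v) × Splits Q v
Splits Q (suc x ∷ v) = Splits (Q ∘ (x ∷_)) v

Splits-elim : ∀ {Q} s t → Splits Q (s ++ 0 ∷ t) → Q (reduce s) (reduce t)
Splits-elim []          t (q , _)  = q
Splits-elim (zero ∷ s)  t (_ , sp) = Splits-elim s t sp
Splits-elim (suc x ∷ s) t sp       = Splits-elim s t sp

Splits-lift : ∀ {Q} p → Splits Q (lift p)
Splits-lift []      = tt
Splits-lift (x ∷ p) = Splits-lift p

Splits-lift++ : ∀ {Q} p v → Splits (λ q → Q (p ++ q)) v → Splits Q (lift p ++ v)
Splits-lift++ []      v sp = sp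
Splits-lift++ (x ∷ p) v sp = Splits-lift++ p v sp

Splits-0^++ : ∀ {Q} n v → Q [] (reduce v) → Splits Q v → Splits Q (0^ n ++ v)
Splits-0^++     zero    v q sp = sp
Splits-0^++ {Q} (suc n) v q sp = subst (Q []) (sym (reduce-0^++ n v)) q , Splits-0^++ n v q sp

-- Act p u says that the new smallest letter may stand between p and u; the letters of p and u
-- are lowered by one.
record Pattern₃ : Set₁ where
  field
    Av  : Word → Set
    Act : Word → Word → Set
    act? : ∀ p u → Dec (Act p u)
    act-[] : ∀ u → Act [] u
    av-[] : Av []
    av-reduce : ∀ {v} → Av v → Av (reduce v)
    av-act : ∀ s t → Av (s ++ 0 ∷ t) → Act (reduce s) (reduce t)
    av-extend : ∀ {v} → Av (reduce v) → Splits Act v → Av v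

AllPairs-⊆ : ∀ {R : ℕ → ℕ → Set} {x y p} → AllPairs R p → x ∷ y ∷ [] ⊆ p → R x y
AllPairs-⊆ (_ ∷ ps)  (_ ∷ʳ s)   = AllPairs-⊆ ps s
AllPairs-⊆ (rs ∷ _)  (refl ∷ s) = All.lookup (Sub.All-resp-⊆ s rs) (here refl)

⊆⇒AllPairs : ∀ {R : ℕ → ℕ → Set} → (∀ x y → Dec (R x y)) → ∀ p →
             (∀ {x y} → ¬ R x y → ¬ x ∷ y ∷ [] ⊆ p) → AllPairs R p
⊆⇒AllPairs R? []      h = []
⊆⇒AllPairs R? (x ∷ p) h =
  All.tabulate (λ y∈p → decidable-stable (R? _ _) λ ¬r → h ¬r (refl ∷ from∈ y∈p)) ∷
  ⊆⇒AllPairs R? p λ ¬r s → h ¬r (x ∷ʳ s)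

-- A reversed occurrence of 123 or 132 ends in its smallest letter, so a new smallest letter only
-- constrains the pairs of letters before it.
module Monotone (R : ℕ → ℕ → Set) (R? : ∀ x y → Dec (R x y))
                (R-suc : ∀ {x y} → R (suc x) (suc y) ⇔ R x y)
                (F : ℕ → ℕ → ℕ → Word)
                (av⇒ : ∀ {v} → Av₃ F v → ∀ {x y z} → ¬ R x y → z < x → z < y → ¬ x ∷ y ∷ z ∷ [] ⊆ v)
                (av⇐ : ∀ {v} → (∀ {x y z} → ¬ R x y → z < x → z < y → ¬ x ∷ y ∷ z ∷ [] ⊆ v) → Av₃ F v)
                where
  pattern₃ : Pattern₃
  pattern₃ = record
    { Av = Av₃ F
    ; Act = λ p _ → AllPairs R p
    ; act? = λ p _ → AllPairs.allPairs? R? p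
    ; act-[] = λ _ → []
    ; av-[] = av⇐ λ _ _ _ ()
    ; av-reduce = λ av → av⇐ λ ¬r z<x z<y s →
        av⇒ av (¬r ∘ to R-suc) (s≤s z<x) (s≤s z<y) (lift-⊆ s)
    ; av-act = λ s t av → ⊆⇒AllPairs R? (reduce s) λ ¬r sub →
        av⇒ av (¬r ∘ to R-suc) (s≤s z≤n) (s≤s z≤n) (Sub.++⁺ (lift-⊆ sub) (refl ∷ minimum t))
    ; av-extend = λ av sp → av⇐ (extend av sp)
    }
    where
    extend : ∀ {v} → Av₃ F (reduce v) → Splits (λ p _ → AllPairs R p) v →
             ∀ {x y z} → ¬ R x y → z < x → z < y → ¬ x ∷ y ∷ z ∷ [] ⊆ v
    extend av sp {suc x} {suc y} {zero} ¬r _ _ s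
      with s , t , refl , sub , _ ← split-⊆ (suc x ∷ suc y ∷ []) s =
      ¬r (from R-suc (AllPairs-⊆ (Splits-elim s t sp) (reduce-⊆ sub)))
    extend av sp {suc x} {suc y} {suc z} ¬r (s≤s z<x) (s≤s z<y) s =
      av⇒ av (¬r ∘ from R-suc) z<x z<y (reduce-⊆ s)

-- Reversed, 123 has a descent before its smallest letter and 132 an ascent. Hence the reversed word
-- must be weakly increasing before a new smallest letter for 123, weakly decreasing for 132.
pattern-123 pattern-132 pattern-213 : Pattern₃
pattern-123 = Monotone.pattern₃ _≤_ _≤?_ (mk⇔ ≤-pred s≤s) F123
  (λ av ¬r z<x z<y → av z<y (≰⇒> ¬r))
  (λ h a<b b<c → h (<⇒≱ b<c) (<-trans a<b b<c) a<b)
pattern-132 = Monotone.pattern₃ _≥_ (λ x y → y ≤? x) (mk⇔ ≤-pred s≤s) F132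
  (λ av ¬r z<x z<y → av z<x (≰⇒> ¬r))
  (λ h a<b b<c → h (<⇒≱ b<c) a<b (<-trans a<b b<c))

-- In a reversed 213 the smallest letter stands between the largest and the middle one, so what is
-- forbidden is a larger letter before the cut and a smaller one after it.
Below : Word → Word → Set
Below p u = All (λ x → All (x ≤_) u) p

pattern-213 = record
  { Av = Av₃ F213
  ; Act = Below
  ; act? = λ p u → All.all? (λ x → All.all? (x ≤?_) u) p
  ; act-[] = λ _ → []
  ; av-[] = λ _ _ ()
  ; av-reduce = λ av a<b b<c s → av (s≤s a<b) (s≤s b<c) (lift-⊆ s)
  ; av-act = λ s t av → All.tabulate λ x∈s → All.tabulate λ y∈t →
      ≮⇒≥ λ y<x → av (s≤s z≤n) (s≤s y<x) (Sub.++⁺ (lift-⊆ {v = s} (from∈ x∈s)) (refl ∷ lift-⊆ {v = t} (from∈ y∈t)))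
  ; av-extend = extend
  }
  where
  extend : ∀ {v} → Av₃ F213 (reduce v) → Splits Below v → Av₃ F213 v
  extend av sp {zero} {suc b} {suc c} _ (s≤s b<c) s
    with s , t , refl , sub , sub′ ← split-⊆ (suc c ∷ []) s =
    <⇒≱ b<c (All.lookup (All.lookup (Splits-elim s t sp) (to∈ (reduce-⊆ sub))) (to∈ (reduce-⊆ sub′)))
  extend av sp {suc a} {suc b} {suc c} (s≤s a<b) (s≤s b<c) s = av a<b b<c (reduce-⊆ s)

-- The two single zeros are the free copies. The runs of `x`, `y` and `z` zeros are the places where
-- forced copies can gather; each of the patterns uses one of the three.
blocks : ℕ → ℕ → ℕ → Word → Word → Word → Word
blocks x y z p q r = 0^ x ++ lift p ++ 0 ∷ 0^ y ++ lift q ++ 0 ∷ 0^ z ++ lift r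

reduce-0^++lift : ∀ z r → reduce (0^ z ++ lift r) ≡ r
reduce-0^++lift z r = trans (reduce-0^++ z _) (reduce-lift r)

reduce-0^++lift++ : ∀ y q v → reduce (0^ y ++ lift q ++ v) ≡ q ++ reduce v
reduce-0^++lift++ y q v = trans (reduce-0^++ y _) (reduce-lift++ q v)

reduce-blocks : ∀ x y z p q r → reduce (blocks x y z p q r) ≡ p ++ q ++ r
reduce-blocks x y z p q r = trans (reduce-0^++lift++ x p _) (cong (p ++_)
  (trans (reduce-0^++lift++ y q _) (cong (q ++_) (reduce-0^++lift z r))))

zeros-0^++lift++ : ∀ y q v → zeros (0^ y ++ lift q ++ v) ≡ y + zeros v
zeros-0^++lift++ y q v = trans (zeros-0^++ y _) (cong (y +_) (zeros-lift++ q v))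

zeros-0^++lift : ∀ z r → zeros (0^ z ++ lift r) ≡ z
zeros-0^++lift z r = trans (zeros-0^++ z _) (trans (cong (z +_) (zeros-lift r)) (+-identityʳ z))

zeros-blocks : ∀ x y z p q r → zeros (blocks x y z p q r) ≡ suc (suc (x + (y + z)))
zeros-blocks x y z p q r = begin
  zeros (blocks x y z p q r)                                ≡⟨ zeros-0^++lift++ x p _ ⟩
  x + suc (zeros (0^ y ++ lift q ++ 0 ∷ 0^ z ++ lift r))    ≡⟨ cong (λ n → x + suc n) (zeros-0^++lift++ y q _) ⟩
  x + suc (y + suc (zeros (0^ z ++ lift r)))                ≡⟨ cong (λ n → x + suc (y + suc n)) (zeros-0^++lift z r) ⟩
  x + suc (y + suc z)                                       ≡⟨ cong (λ n → x + suc n) (+-suc y z) ⟩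
  x + suc (suc (y + z))                                     ≡⟨ +-suc x _ ⟩
  suc (x + suc (y + z))                                     ≡⟨ cong suc (+-suc x _) ⟩
  suc (suc (x + (y + z)))                                   ∎
  where open ≡-Reasoning

-- Lifted letters are positive, so the first 0 marks the end of `p`.
lift-injective-until-0 : ∀ p p′ {t t′} → lift p ++ 0 ∷ t ≡ lift p′ ++ 0 ∷ t′ → p ≡ p′ × t ≡ t′
lift-injective-until-0 []      []        eq = refl , ∷-injectiveʳ eq
lift-injective-until-0 (x ∷ p) (x′ ∷ p′) eq
  with refl ← ∷-injectiveˡ eq | refl , eq′ ← lift-injective-until-0 p p′ (∷-injectiveʳ eq) = refl , eq′

blocks-injective : ∀ x y z {p q r p′ q′ r′} → blocks x y z p q r ≡ blocks x y z p′ q′ r′ →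
                   p ≡ p′ × q ≡ q′ × r ≡ r′
blocks-injective x y z eq
  with refl , eq₁ ← lift-injective-until-0 _ _ (++-cancelˡ (0^ x) _ _ eq)
  with refl , eq₂ ← lift-injective-until-0 _ _ (++-cancelˡ (0^ y) _ _ eq₁)
  = refl , refl , map-injective suc-injective (++-cancelˡ (0^ z) _ _ eq₂)

-- The repeated letter is the smallest one, so words with c + 2 zeros are constrained by F 0 (suc b)
-- to be of the form blocks; p, q and r may be empty.
record Pattern₄ : Set where
  field
    F         : ℕ → ℕ → Word
    x y z     : ℕ → ℕ
    x+y+z     : ∀ c → x c + (y c + z c) ≡ c
    reduce-F  : ∀ a b → reduce (F (suc a) (suc b)) ≡ F a b
    lift-F    : ∀ a b → lift (F a b) ≡ F (suc a) (suc b)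
    []-avoids : Av₄ F []
    zeros-F   : ∀ b → zeros (F 0 (suc b)) ≡ 3
    F⊈blocks  : ∀ c p q r {b} → ¬ F 0 (suc b) ⊆ blocks (x c) (y c) (z c) p q r
    to-blocks : ∀ {c} v → (∀ {b} → ¬ F 0 (suc b) ⊆ v) → zeros v ≡ suc (suc c) →
                ∃[ p ] ∃[ q ] ∃[ r ] v ≡ blocks (x c) (y c) (z c) p q r

  Av : Word → Set
  Av = Av₄ F

drop-0^ : ∀ {x σ} n v → suc x ∷ σ ⊆ 0^ n ++ v → suc x ∷ σ ⊆ v
drop-0^ zero    v s        = s
drop-0^ (suc n) v (_ ∷ʳ s) = drop-0^ n v s

-- Greedy matching: the leading 0 may be matched with the earliest 0.
drop-lift0 : ∀ {σ} p v → 0 ∷ σ ⊆ lift p ++ 0 ∷ v → σ ⊆ v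
drop-lift0 []      v (_ ∷ʳ s)   = Sub.∷ˡ⁻ s
drop-lift0 []      v (refl ∷ s) = s
drop-lift0 (x ∷ p) v (_ ∷ʳ s)   = drop-lift0 p v s

-- A positive letter met before `c` zeros have been read has at least `k + 1` zeros behind it, which
-- the hypothesis forbids.
leading-zeros : ∀ c {k} v → (∀ {b} → ¬ suc b ∷ 0^ (suc k) ⊆ v) → zeros v ≡ c + k →
                ∃[ t ] v ≡ 0^ c ++ t × zeros t ≡ k
leading-zeros zero    v           av eq = v , refl , eq
leading-zeros (suc c) (zero ∷ v)  av eq
  with t , refl , eq′ ← leading-zeros c v (λ s → av (0 ∷ʳ s)) (suc-injective eq) = t , refl , eq′
leading-zeros (suc c) {k} (suc x ∷ v) av eq =
  contradiction (refl ∷ zeros⇒⊆ (suc k) v (subst (suc k ≤_) (sym eq) (s≤s (m≤n+m k c)))) av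
  where
  zeros⇒⊆ : ∀ k v → k ≤ zeros v → 0^ k ⊆ v
  zeros⇒⊆ zero    v           le       = minimum v
  zeros⇒⊆ (suc k) (zero ∷ v)  (s≤s le) = refl ∷ zeros⇒⊆ k v le
  zeros⇒⊆ (suc k) (suc x ∷ v) le       = suc x ∷ʳ zeros⇒⊆ (suc k) v le

too-many-zeros : ∀ {σ v} → zeros v < zeros σ → ¬ σ ⊆ v
too-many-zeros lt s = <⇒≱ lt (zeros-⊆ s)

-- The reversed patterns are `b000`, `0b00` and `00b0`. After zero, one or two initial zeros
-- respectively, at most two, one or no zeros may follow a positive letter, so the surplus copies
-- come immediately at that point.
pattern-1112 pattern-1121 pattern-1211 : Pattern₄
pattern-1112 = record
  { F = F1112 ; x = λ c → c ; y = λ _ → 0 ; z = λ _ → 0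
  ; x+y+z = +-identityʳ
  ; reduce-F = λ _ _ → refl ; lift-F = λ _ _ → refl ; []-avoids = λ _ () ; zeros-F = λ _ → refl
  -- The positive letter of the pattern must be matched after the `c` leading zeros, where only two
  -- zeros are left for three.
  ; F⊈blocks = λ c p q r s → too-many-zeros
      (s≤s (≤-reflexive (zeros-blocks 0 0 0 p q r))) (drop-0^ c _ s)
  ; to-blocks = shape
  }
  where
  shape : ∀ {c} v → (∀ {b} → ¬ F1112 0 (suc b) ⊆ v) → zeros v ≡ suc (suc c) →
          ∃[ p ] ∃[ q ] ∃[ r ] v ≡ blocks c 0 0 p q r
  shape {c} v av eq
    with t , refl , eq₁ ← leading-zeros c v av (trans eq (sym (trans (+-suc c 1) (cong suc (trans (+-suc c 0) (cong suc (+-identityʳ c)))))))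
    with p , u , refl , eq₂ ← first-zero t eq₁
    with q , w , refl , eq₃ ← first-zero u eq₂
    = p , q , reduce w , cong (λ w → 0^ c ++ lift p ++ 0 ∷ lift q ++ 0 ∷ w) (zeros≡0⇒lift w eq₃)

pattern-1121 = record
  { F = F1121 ; x = λ _ → 0 ; y = λ c → c ; z = λ _ → 0
  ; x+y+z = +-identityʳ
  ; reduce-F = λ _ _ → refl ; lift-F = λ _ _ → refl ; []-avoids = λ _ () ; zeros-F = λ _ → refl
  ; F⊈blocks = λ c p q r s → too-many-zeros
      (s≤s (≤-reflexive (trans (zeros-lift++ q _) (cong suc (zeros-lift r))))) (drop-0^ c _ (drop-lift0 p _ s))
  ; to-blocks = shape
  }
  where
  shape : ∀ {c} v → (∀ {b} → ¬ F1121 0 (suc b) ⊆ v) → zeros v ≡ suc (suc c) →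
          ∃[ p ] ∃[ q ] ∃[ r ] v ≡ blocks 0 c 0 p q r
  shape {c} v av eq
    with p , t , refl , eq₁ ← first-zero v eq
    with u , refl , eq₂ ← leading-zeros c t (λ s → av (Sub.++⁺ (minimum (lift p)) (refl ∷ s))) (trans eq₁ (+-comm 1 c))
    with q , w , refl , eq₃ ← first-zero u eq₂
    = p , q , reduce w , cong (λ w → lift p ++ 0 ∷ 0^ c ++ lift q ++ 0 ∷ w) (zeros≡0⇒lift w eq₃)

pattern-1211 = record
  { F = F1211 ; x = λ _ → 0 ; y = λ _ → 0 ; z = λ c → c
  ; x+y+z = λ _ → refl
  ; reduce-F = λ _ _ → refl ; lift-F = λ _ _ → refl ; []-avoids = λ _ () ; zeros-F = λ _ → refl
  ; F⊈blocks = λ c p q r s → too-many-zeros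
      (s≤s (≤-reflexive (zeros-lift r))) (drop-0^ c _ (drop-lift0 q _ (drop-lift0 p _ s)))
  ; to-blocks = shape
  }
  where
  shape : ∀ {c} v → (∀ {b} → ¬ F1211 0 (suc b) ⊆ v) → zeros v ≡ suc (suc c) →
          ∃[ p ] ∃[ q ] ∃[ r ] v ≡ blocks 0 0 c p q r
  shape {c} v av eq
    with p , t , refl , eq₁ ← first-zero v eq
    with q , u , refl , eq₂ ← first-zero t eq₁
    with w , refl , eq₃ ← leading-zeros c u (λ s → av (Sub.++⁺ (minimum (lift p)) (refl ∷ Sub.++⁺ (minimum (lift q)) (refl ∷ s))))
                            (trans eq₂ (sym (+-identityʳ c)))
    = p , q , reduce w , cong (λ w → lift p ++ 0 ∷ lift q ++ 0 ∷ 0^ c ++ w) (zeros≡0⇒lift w eq₃)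

-- Lists without repetition and sums over lists

Unique-concatMap : ∀ {A B : Set} (f : A → List B) {xs} → Unique xs → (∀ x → Unique (f x)) →
                   (∀ {x x′ y} → y ∈ f x → y ∈ f x′ → x ≡ x′) → Unique (concatMap f xs)
Unique-concatMap f []         uf inj = []
Unique-concatMap f {x ∷ xs} (x∉xs ∷ uxs) uf inj =
  Unique.++⁺ (uf x) (Unique-concatMap f uxs uf inj) λ (y∈fx , y∈fxs) →
    let x′ , x′∈xs , y∈fx′ = find (∈-concatMap⁻ f y∈fxs)
    in All.lookup x∉xs x′∈xs (inj y∈fx y∈fx′)

total : ∀ {A : Set} → (A → ℕ) → List A → ℕ
total f xs = sum (map f xs)

total-map : ∀ {A B : Set} (f : B → ℕ) (g : A → B) xs → total f (map g xs) ≡ total (f ∘ g) xs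
total-map f g xs = cong sum (sym (map-∘ xs))

total-cong : ∀ {A : Set} {f g : A → ℕ} xs → (∀ {x} → x ∈ xs → f x ≡ g x) → total f xs ≡ total g xs
total-cong []       eq = refl
total-cong (x ∷ xs) eq = cong₂ _+_ (eq (here refl)) (total-cong xs (eq ∘ there))

total-concatMap : ∀ {A B : Set} (f : B → ℕ) (g : A → List B) xs →
                  total f (concatMap g xs) ≡ total (total f ∘ g) xs
total-concatMap f g []       = refl
total-concatMap f g (x ∷ xs) = begin
  sum (map f (g x ++ concatMap g xs))            ≡⟨ cong sum (map-++ f (g x) _) ⟩
  sum (map f (g x) ++ map f (concatMap g xs))    ≡⟨ sum-++ (map f (g x)) _ ⟩
  total f (g x) + total f (concatMap g xs)       ≡⟨ cong (total f (g x) +_) (total-concatMap f g xs) ⟩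
  total f (g x) + total (total f ∘ g) xs         ∎
  where open ≡-Reasoning

length≡total : ∀ {A : Set} (xs : List A) → length xs ≡ total (λ _ → 1) xs
length≡total []       = refl
length≡total (x ∷ xs) = cong suc (length≡total xs)

-- Active cuts

-- slots p u lists the cuts of u at which p ++ u may be cut.
module Slots (P : Pattern₃) where
  open Pattern₃ P

  cons-if : ∀ {Q A : Set} → Dec Q → A → List A → List A
  cons-if (yes _) x xs = x ∷ xs
  cons-if (no _)  x xs = xs

  slots : Word → Word → List (Word × Word)
  slots p []      = cons-if (act? p []) ([] , []) []
  slots p (x ∷ u) = cons-if (act? p (x ∷ u)) ([] , x ∷ u) (map (map₁ (x ∷_)) (slots (p ++ x ∷ []) u))

  ∈-slots⁺ : ∀ p q r → Act (p ++ q) r → (q , r) ∈ slots p (q ++ r)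
  ∈-slots⁺ p [] [] act with act? p []
  ... | yes _   = here refl
  ... | no ¬act = contradiction (subst (λ p → Act p []) (++-identityʳ p) act) ¬act
  ∈-slots⁺ p [] (x ∷ r) act with act? p (x ∷ r)
  ... | yes _   = here refl
  ... | no ¬act = contradiction (subst (λ p → Act p (x ∷ r)) (++-identityʳ p) act) ¬act
  ∈-slots⁺ p (x ∷ q) r act = ∈-cons-if (act? p (x ∷ q ++ r)) (∈-map⁺ (map₁ (x ∷_))
    (∈-slots⁺ (p ++ x ∷ []) q r (subst (λ p → Act p r) (sym (++-assoc p (x ∷ []) q)) act)))
    where
    ∈-cons-if : ∀ {Q A : Set} {x y : A} {xs} (Q? : Dec Q) → x ∈ xs → x ∈ cons-if Q? y xs
    ∈-cons-if (yes _) x∈xs = there x∈xs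
    ∈-cons-if (no _)  x∈xs = x∈xs

  ∈-slots⁻ : ∀ p u {q r} → (q , r) ∈ slots p u → q ++ r ≡ u × Act (p ++ q) r
  ∈-slots⁻ p [] s with act? p []
  ∈-slots⁻ p [] (here refl) | yes act = refl , subst (λ p → Act p []) (sym (++-identityʳ p)) act
  ∈-slots⁻ p (x ∷ u) s with act? p (x ∷ u)
  ∈-slots⁻ p (x ∷ u) (here refl) | yes act = refl , subst (λ p → Act p (x ∷ u)) (sym (++-identityʳ p)) act
  ∈-slots⁻ p (x ∷ u) (there s)   | yes act = ∈-slots⁻-∷ s
    where
    ∈-slots⁻-∷ : ∀ {q r} → (q , r) ∈ map (map₁ (x ∷_)) (slots (p ++ x ∷ []) u) → q ++ r ≡ x ∷ u × Act (p ++ q) r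
    ∈-slots⁻-∷ s with (q , r) , s′ , refl ← ∈-map⁻ (map₁ (x ∷_)) s =
      let eq , act = ∈-slots⁻ (p ++ x ∷ []) u s′ in cong (x ∷_) eq , subst (λ p → Act p r) (++-assoc p (x ∷ []) q) act
  ∈-slots⁻ p (x ∷ u) s | no _ with (q , r) , s′ , refl ← ∈-map⁻ (map₁ (x ∷_)) s =
    let eq , act = ∈-slots⁻ (p ++ x ∷ []) u s′ in cong (x ∷_) eq , subst (λ p → Act p r) (++-assoc p (x ∷ []) q) act

  slots-unique : ∀ p u → Unique (slots p u)
  slots-unique p [] with act? p []
  ... | yes _ = [] ∷ []
  ... | no _  = []
  slots-unique p (x ∷ u) with act? p (x ∷ u) | Unique.map⁺ {f = map₁ (x ∷_)} (λ { refl → refl }) (slots-unique (p ++ x ∷ []) u)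
  ... | yes _ | tail! = All.map⁺ (All.tabulate λ _ ()) ∷ tail!
  ... | no _  | tail! = tail!

  -- Cuts strictly inside `p` are left out: once a first copy stands after `p`, these are the places
  -- for the second one.
  degree : Word → Word → ℕ
  degree p u = length (slots p u)

-- The multiplicities are suc c for c in the list.
HasMults : List ℕ → Word → Set
HasMults []       v = v ≡ []
HasMults (c ∷ cs) v = zeros v ≡ suc c × HasMults cs (reduce v)

-- The generating tree

module Tree (A : Pattern₃) (B : Pattern₄) where
  private
    module A = Pattern₃ A
    module B = Pattern₄ B
  open Slots A

  Good : Word → Set
  Good v = A.Av v × B.Av v

  good-reduce : ∀ {v} → Good v → Good (reduce v)
  good-reduce (a , b) = A.av-reduce a , λ {i} {j} i<j s →
    b (s≤s i<j) (subst (_⊆ _) (B.lift-F i j) (lift-⊆ s))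

  -- A 0 can only play the repeated letter of the four-letter pattern, so an occurrence either is
  -- excluded by the last hypothesis or has no 0 and survives in `reduce v`.
  good-extend : ∀ {v} → Good (reduce v) → Splits A.Act v → (∀ {b} → ¬ B.F 0 (suc b) ⊆ v) → Good v
  good-extend {v} (a , b) sp F⊈v = A.av-extend a sp , extend
    where
    extend : B.Av v
    extend {zero}  {suc j} _         s = F⊈v s
    extend {suc i} {suc j} (s≤s i<j) s = b i<j (subst (_⊆ reduce v) (B.reduce-F i j) (reduce-⊆ s))

  place₁ : Word × Word → Word
  place₁ (p , r) = lift p ++ 0 ∷ lift r

  place : ℕ → Word → Word × Word → Word
  place c p (q , r) = blocks (B.x c) (B.y c) (B.z c) p q r

  places : ℕ → Word × Word → List Word
  places c (p , u) = map (place c p) (slots p u)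

  -- insert c w adds suc c copies of the new smallest letter to w.
  insert : ℕ → Word → List Word
  insert zero    w = map place₁ (slots [] w)
  insert (suc c) w = concatMap (places c) (slots [] w)

  reduce-place₁ : ∀ p r → reduce (place₁ (p , r)) ≡ p ++ r
  reduce-place₁ p r = trans (reduce-lift++ p _) (cong (p ++_) (reduce-lift r))

  reduce-insert : ∀ c {v w} → v ∈ insert c w → reduce v ≡ w
  reduce-insert zero {w = w} v∈
    with (p , r) , s , refl ← ∈-map⁻ place₁ v∈
    with refl , _ ← ∈-slots⁻ [] w s
    = reduce-place₁ p r
  reduce-insert (suc c) {w = w} v∈
    with (p , u) , s , v∈′ ← find (∈-concatMap⁻ (places c) v∈)
    with (q , r) , s′ , refl ← ∈-map⁻ (place c p) v∈′
    with refl , _ ← ∈-slots⁻ [] w s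
    with refl , _ ← ∈-slots⁻ p u s′
    = reduce-blocks (B.x c) (B.y c) (B.z c) p q r

  insert-sound : ∀ c {v w} → Good w → v ∈ insert c w → Good v × zeros v ≡ suc c × reduce v ≡ w
  insert-sound zero {w = w} good v∈
    with (p , r) , s , refl ← ∈-map⁻ place₁ v∈
    with refl , act ← ∈-slots⁻ [] w s
    = good-extend (subst Good (sym red) good)
        (Splits-lift++ p _ (subst₂ A.Act (sym (++-identityʳ p)) (sym (reduce-lift r)) act , Splits-lift r))
        (λ {b} → too-many-zeros (≤-trans (s≤s (≤-reflexive zs)) (subst (2 ≤_) (sym (B.zeros-F b)) (s≤s (s≤s z≤n)))))
    , zs , red
    where
    red = reduce-place₁ p r
    zs : zeros (lift p ++ 0 ∷ lift r) ≡ 1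
    zs = trans (zeros-lift++ p _) (cong suc (zeros-lift r))
  insert-sound (suc c) {w = w} good v∈
    with (p , u) , s , v∈′ ← find (∈-concatMap⁻ (places c) v∈)
    with (q , r) , s′ , refl ← ∈-map⁻ (place c p) v∈′
    with refl , act ← ∈-slots⁻ [] w s
    with refl , act′ ← ∈-slots⁻ p u s′
    = good-extend (subst Good (sym red) good) splits (B.F⊈blocks c p q r)
    , trans (zeros-blocks (B.x c) (B.y c) (B.z c) p q r) (cong (suc ∘ suc) (B.x+y+z c))
    , red
    where
    red = reduce-blocks (B.x c) (B.y c) (B.z c) p q r
    red-r = reduce-0^++lift (B.z c) r
    red-qr : reduce (0^ (B.y c) ++ lift q ++ 0 ∷ 0^ (B.z c) ++ lift r) ≡ q ++ r
    red-qr = trans (reduce-0^++lift++ (B.y c) q _) (cong (q ++_) red-r)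
    act-p : ∀ {u} → u ≡ q ++ r → A.Act (p ++ []) u
    act-p eq = subst₂ A.Act (sym (++-identityʳ p)) (sym eq) act
    act-q : ∀ {u} → u ≡ r → A.Act (p ++ (q ++ [])) u
    act-q eq = subst₂ A.Act (cong (p ++_) (sym (++-identityʳ q))) (sym eq) act′
    splits : Splits A.Act (place c p (q , r))
    -- Forced copies before `p` stand at the empty cut, which is always active; those before `q` and
    -- `r` share the cut of the free copy in front of them.
    splits = Splits-0^++ (B.x c) _ (A.act-[] _) (Splits-lift++ p _
      ( act-p red-qr
      , Splits-0^++ (B.y c) _ (act-p (trans (reduce-lift++ q _) (cong (q ++_) red-r))) (Splits-lift++ q _
          ( act-q red-r
          , Splits-0^++ (B.z c) _ (act-q (reduce-lift r)) (Splits-lift r)))))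

  insert-complete : ∀ c {v} → Good v → zeros v ≡ suc c → v ∈ insert c (reduce v)
  insert-complete zero {v} (a , _) eq
    with p , t , refl , eq₁ ← first-zero v eq
    with act ← A.av-act (lift p) t a
    rewrite reduce-lift++ p (0 ∷ t) | reduce-lift p =
    subst (λ u → lift p ++ 0 ∷ u ∈ map place₁ (slots [] (p ++ reduce t))) (sym (zeros≡0⇒lift t eq₁))
      (∈-map⁺ place₁ (∈-slots⁺ [] p (reduce t) act))
  insert-complete (suc c) {v} (a , b) eq
    with p , q , r , refl ← B.to-blocks v (b (s≤s z≤n)) eq =
    subst (λ w → place c p (q , r) ∈ insert (suc c) w) (sym (reduce-blocks x y z p q r))
      (∈-concatMap⁺ (places c) (lose (∈-slots⁺ [] p (q ++ r) act-p) (∈-map⁺ (place c p) (∈-slots⁺ p q r act-q))))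
    where
    x = B.x c
    y = B.y c
    z = B.z c
    act-p : A.Act p (q ++ r)
    act-p = subst₂ A.Act (trans (reduce-0^++ x _) (reduce-lift p))
      (trans (reduce-0^++lift++ y q _) (cong (q ++_) (reduce-0^++lift z r)))
      (A.av-act (0^ x ++ lift p) _ (subst A.Av (sym (++-assoc (0^ x) (lift p) _)) a))
    s = 0^ x ++ lift p ++ 0 ∷ 0^ y ++ lift q
    reassoc : blocks x y z p q r ≡ s ++ 0 ∷ 0^ z ++ lift r
    reassoc = sym (trans (++-assoc (0^ x) _ _) (cong (0^ x ++_) (trans (++-assoc (lift p) _ _)
      (cong (λ t → lift p ++ 0 ∷ t) (++-assoc (0^ y) (lift q) _)))))
    act-q : A.Act (p ++ q) r
    act-q = subst₂ A.Act (trans (reduce-0^++lift++ x p _) (cong (p ++_) (reduce-0^++lift y q)))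
      (reduce-0^++lift z r) (A.av-act s _ (subst A.Av reassoc a))

  insert-unique : ∀ c w → Unique (insert c w)
  insert-unique zero    w = Unique.map⁺ place₁-injective (slots-unique [] w)
    where
    place₁-injective : ∀ {s t} → place₁ s ≡ place₁ t → s ≡ t
    place₁-injective eq with refl , eq′ ← lift-injective-until-0 _ _ eq =
      cong (_ ,_) (map-injective suc-injective eq′)
  insert-unique (suc c) w = Unique-concatMap (places c) (slots-unique [] w)
    (λ (p , u) → Unique.map⁺ place-injective (slots-unique p u))
    disjoint
    where
    place-injective : ∀ {p s t} → place c p s ≡ place c p t → s ≡ t
    place-injective eq with _ , refl , refl ← blocks-injective (B.x c) (B.y c) (B.z c) eq = refl
    disjoint : ∀ {s t v} → v ∈ places c s → v ∈ places c t → s ≡ t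
    disjoint {p , u} {p′ , u′} v∈ v∈′
      with (q , r) , s , refl ← ∈-map⁻ (place c p) v∈
      with (q′ , r′) , s′ , eq ← ∈-map⁻ (place c p′) v∈′
      with refl , refl , refl ← blocks-injective (B.x c) (B.y c) (B.z c) {p} {q} {r} {p′} {q′} {r′} eq
      = cong (p ,_) (trans (sym (proj₁ (∈-slots⁻ p u s))) (proj₁ (∈-slots⁻ p u′ s′)))

  -- The head of the list belongs to the smallest letter, which is inserted last.
  generate : List ℕ → List Word
  generate []       = [] ∷ []
  generate (c ∷ cs) = concatMap (insert c) (generate cs)

  ∈-generate⁻ : ∀ cs {v} → v ∈ generate cs → Good v × HasMults cs v
  ∈-generate⁻ []       (here refl) = (A.av-[] , B.[]-avoids) , refl
  ∈-generate⁻ (c ∷ cs) v∈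
    with w , w∈ , v∈′ ← find (∈-concatMap⁻ (insert c) v∈)
    with good-w , mults ← ∈-generate⁻ cs w∈
    with good , zs , refl ← insert-sound c good-w v∈′
    = good , zs , mults

  ∈-generate⁺ : ∀ cs {v} → Good v → HasMults cs v → v ∈ generate cs
  ∈-generate⁺ []       good refl         = here refl
  ∈-generate⁺ (c ∷ cs) good (zs , mults) =
    ∈-concatMap⁺ (insert c) (lose (∈-generate⁺ cs (good-reduce good) mults) (insert-complete c good zs))

  -- `reduce` recovers the parent, so different parents share no child.
  generate-unique : ∀ cs → Unique (generate cs)
  generate-unique []       = [] ∷ []
  generate-unique (c ∷ cs) = Unique-concatMap (insert c) (generate-unique cs) (insert-unique c)
    λ v∈ v∈′ → trans (sym (reduce-insert c v∈)) (reduce-insert c v∈′)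

-- Avoiding multipermutations as nodes of the tree

occurrences-zero : ∀ v → occurrences 0 v ≡ zeros v
occurrences-zero []          = refl
occurrences-zero (zero ∷ v)  = cong suc (occurrences-zero v)
occurrences-zero (suc x ∷ v) = occurrences-zero v

occurrences-suc : ∀ i v → occurrences (suc i) v ≡ occurrences i (reduce v)
occurrences-suc i []          = refl
occurrences-suc i (zero ∷ v)  = occurrences-suc i v
occurrences-suc i (suc x ∷ v) with i ≡ᵇ x
... | true  = cong suc (occurrences-suc i v)
... | false = occurrences-suc i v

occurrences-decode : ∀ i v → occurrences (suc i) (decode v) ≡ occurrences i v
occurrences-decode i v = trans (occurrences-suc i (decode v))
  (trans (cong (occurrences i) (reduce-lift (reverse v))) (↭-length (filter-↭ (i ≟_) (↭-reverse v))))

HasMults⇒ : ∀ {k} (m : Fin k → ℕ) v → HasMults (tabulate m) v →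
            (∀ i → occurrences (toℕ i) v ≡ suc (m i)) × All (_< k) v
HasMults⇒ {zero}  m v refl       = (λ ()) , []
HasMults⇒ {suc k} m v (zs , mults) =
  (λ { Fin.zero    → trans (occurrences-zero v) zs
     ; (Fin.suc i) → trans (occurrences-suc (toℕ i) v) (proj₁ ih i) }) ,
  below v (proj₂ ih)
  where
  ih = HasMults⇒ (m ∘ Fin.suc) (reduce v) mults
  below : ∀ v → All (_< k) (reduce v) → All (_< suc k) v
  below []          _        = []
  below (zero ∷ v)  ps       = s≤s z≤n ∷ below v ps
  below (suc x ∷ v) (p ∷ ps) = s≤s p ∷ below v ps

⇒HasMults : ∀ {k} (m : Fin k → ℕ) v → (∀ i → occurrences (toℕ i) v ≡ suc (m i)) → All (_< k) v →
            HasMults (tabulate m) v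
⇒HasMults {zero}  m []      occ []       = refl
⇒HasMults {suc k} m v occ letters =
  trans (sym (occurrences-zero v)) (occ Fin.zero) ,
  ⇒HasMults (m ∘ Fin.suc) (reduce v)
    (λ i → trans (sym (occurrences-suc (toℕ i) v)) (occ (Fin.suc i))) (below v letters)
  where
  below : ∀ v → All (_< suc k) v → All (_< k) (reduce v)
  below []          _            = []
  below (zero ∷ v)  (_ ∷ ps)     = below v ps
  below (suc x ∷ v) (s≤s p ∷ ps) = p ∷ below v ps

module _ (S : Multiset) where
  open Multiset using (k; mult; mult≥1)

  excess : List ℕ
  excess = tabulate (pred ∘ mult S)

  suc-pred-mult : ∀ i → suc (pred (mult S i)) ≡ mult S i
  suc-pred-mult i = suc-pred (mult S i) ⦃ >-nonZero (mult≥1 S i) ⦄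

  HasMults⇔ : ∀ v → HasMults excess v ⇔ IsMultipermutation S (decode v)
  HasMults⇔ v = mk⇔
    (λ h → let occ , letters = HasMults⇒ _ v h in
       (λ i → trans (occurrences-decode (toℕ i) v) (trans (occ i) (suc-pred-mult i))) ,
       All.map⁺ (All.map (λ p → s≤s z≤n , p) (All-resp-↭ (↭-sym (↭-reverse v)) letters)))
    (λ (occ , letters) → ⇒HasMults _ v
       (λ i → trans (sym (occurrences-decode (toℕ i) v)) (trans (occ i) (sym (suc-pred-mult i))))
       (All-resp-↭ (↭-reverse v) (All.map proj₂ (All.map⁻ letters))))

  decode-surjective : ∀ π → All (λ x → 1 ≤ x × x ≤ k S) π → ∃[ v ] π ≡ decode v
  decode-surjective π letters = reverse (map pred π) , trans (shift π letters) (cong lift (sym (reverse-involutive _)))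
    where
    shift : ∀ π → All (λ x → 1 ≤ x × x ≤ k S) π → π ≡ lift (map pred π)
    shift []          _        = refl
    shift (suc x ∷ π) (_ ∷ ps) = cong (suc x ∷_) (shift π ps)

  -- Both lists are free of repetitions and have the same elements, hence are permutations of each
  -- other.
  av≡length-generate : ∀ P A B → (∀ v → Tree.Good A B v ⇔ AvoidsAll P (decode v)) →
                       av S P ≡ length (Tree.generate A B excess)
  av≡length-generate P A B good⇔ = trans
    (↭-length (∼bag⇒↭ (unique∧set⇒bag
      (Unique.filter⁺ (avoidsAll? P) (multipermutations-unique S))
      (Unique.map⁺ decode-injective (generate-unique excess))
      (mk⇔ ⇒generated generated⇒))))
    (length-map decode (generate excess))
    where
    open Tree A B
    decode-injective : ∀ {v w} → decode v ≡ decode w → v ≡ w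
    decode-injective eq = reverse-injective (map-injective suc-injective eq)

    ⇒generated : ∀ {π} → π ∈ filter (avoidsAll? P) (multipermutations S) → π ∈ map decode (generate excess)
    ⇒generated {π} π∈
      with π∈mp , avoids ← ∈-filter⁻ (avoidsAll? P) {xs = multipermutations S} π∈
      with mp ← to (∈-multipermutations S π) π∈mp
      with v , refl ← decode-surjective π (proj₂ mp)
      = ∈-map⁺ decode (∈-generate⁺ excess (from (good⇔ v) avoids) (from (HasMults⇔ v) mp))

    generated⇒ : ∀ {π} → π ∈ map decode (generate excess) → π ∈ filter (avoidsAll? P) (multipermutations S)
    generated⇒ π∈
      with v , v∈ , refl ← ∈-map⁻ decode π∈
      with good , mults ← ∈-generate⁻ excess v∈
      = ∈-filter⁺ (avoidsAll? P) (from (∈-multipermutations S _) (to (HasMults⇔ v) mults)) (to (good⇔ v) good)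

-- Degrees of the children

-- The slot with i slots before it, out of i + m, is the first of m slots; cascade sums over both
-- parameters.
cascade : (ℕ → ℕ → ℕ) → ℕ → ℕ
cascade g zero    = 0
cascade g (suc n) = g 0 (suc n) + cascade (g ∘ suc) n

cascade-cong : ∀ {g h : ℕ → ℕ → ℕ} → (∀ i m → g i m ≡ h i m) → ∀ n → cascade g n ≡ cascade h n
cascade-cong eq zero    = refl
cascade-cong eq (suc n) = cong₂ _+_ (eq 0 (suc n)) (cascade-cong (eq ∘ suc) n)

module SlotSums (P : Pattern₃) where
  open Pattern₃ P
  open Slots P

  slots-[] : ∀ {p} → Act p [] → slots p [] ≡ ([] , []) ∷ []
  slots-[] {p} act with act? p []
  ... | yes _   = refl
  ... | no ¬act = contradiction act ¬act

  slots-yes : ∀ {p x u} → Act p (x ∷ u) →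
              slots p (x ∷ u) ≡ ([] , x ∷ u) ∷ map (map₁ (x ∷_)) (slots (p ++ x ∷ []) u)
  slots-yes {p} {x} {u} act with act? p (x ∷ u)
  ... | yes _   = refl
  ... | no ¬act = contradiction act ¬act

  slots-no : ∀ {p x u} → ¬ Act p (x ∷ u) →
             slots p (x ∷ u) ≡ map (map₁ (x ∷_)) (slots (p ++ x ∷ []) u)
  slots-no {p} {x} {u} ¬act with act? p (x ∷ u)
  ... | yes act = contradiction act ¬act
  ... | no _    = refl

  degree-[] : ∀ {p} → Act p [] → degree p [] ≡ 1
  degree-[] act = cong length (slots-[] act)

  degree-yes : ∀ {p x u} → Act p (x ∷ u) → degree p (x ∷ u) ≡ suc (degree (p ++ x ∷ []) u)
  degree-yes {p} {x} {u} act = trans (cong length (slots-yes act)) (cong suc (length-map (map₁ (x ∷_)) (slots (p ++ x ∷ []) u)))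

  degree-no : ∀ {p x u} → ¬ Act p (x ∷ u) → degree p (x ∷ u) ≡ degree (p ++ x ∷ []) u
  degree-no {p} {x} {u} ¬act = trans (cong length (slots-no ¬act)) (length-map (map₁ (x ∷_)) (slots (p ++ x ∷ []) u))

  weigh : (Word → ℕ → ℕ) → Word → Word × Word → ℕ
  weigh g p (q , r) = g q (degree (p ++ q) r)

  slot-sum : (Word → ℕ → ℕ) → Word → Word → ℕ
  slot-sum g p u = total (weigh g p) (slots p u)

  shift-sum : ∀ g p x u → total (weigh g p) (map (map₁ (x ∷_)) (slots (p ++ x ∷ []) u)) ≡
              slot-sum (λ q → g (x ∷ q)) (p ++ x ∷ []) u
  shift-sum g p x u = trans (total-map (weigh g p) (map₁ (x ∷_)) (slots (p ++ x ∷ []) u))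
    (total-cong (slots (p ++ x ∷ []) u) λ {(q , r)} _ →
      cong (λ s → g (x ∷ q) (degree s r)) (sym (++-assoc p (x ∷ []) q)))

  slot-sum-[] : ∀ {g p} → Act p [] → slot-sum g p [] ≡ g [] (degree p []) + 0
  slot-sum-[] {g} {p} act = trans (cong (total (weigh g p)) (slots-[] act))
    (cong (λ s → g [] (degree s []) + 0) (++-identityʳ p))

  slot-sum-yes : ∀ {g p x u} → Act p (x ∷ u) →
                 slot-sum g p (x ∷ u) ≡ g [] (degree p (x ∷ u)) + slot-sum (λ q → g (x ∷ q)) (p ++ x ∷ []) u
  slot-sum-yes {g} {p} {x} {u} act = trans (cong (total (weigh g p)) (slots-yes act))
    (cong₂ _+_ (cong (λ s → g [] (degree s (x ∷ u))) (++-identityʳ p)) (shift-sum g p x u))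

  slot-sum-no : ∀ {g p x u} → ¬ Act p (x ∷ u) →
                slot-sum g p (x ∷ u) ≡ slot-sum (λ q → g (x ∷ q)) (p ++ x ∷ []) u
  slot-sum-no {g} {p} {x} {u} ¬act = trans (cong (total (weigh g p)) (slots-no ¬act)) (shift-sum g p x u)

  -- From left to right, the numbers of slots still available are `n`, `n - 1`, ..., 1, however the
  -- slots are spaced.
  slot-sum-degree : ∀ h p u → slot-sum (λ _ → h) p u ≡ cascade (λ _ → h) (degree p u)
  slot-sum-degree h p [] with act? p []
  ... | yes act = cong (λ s → h s + 0) (trans (cong (λ p → degree p []) (++-identityʳ p)) (degree-[] act))
  ... | no _    = refl
  slot-sum-degree h p (x ∷ u) = go (act? p (x ∷ u))
    where
    go : Dec (Act p (x ∷ u)) → slot-sum (λ _ → h) p (x ∷ u) ≡ cascade (λ _ → h) (degree p (x ∷ u))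
    go (yes act) = begin
      slot-sum (λ _ → h) p (x ∷ u)                                       ≡⟨ slot-sum-yes {λ _ → h} act ⟩
      h (degree p (x ∷ u)) + slot-sum (λ _ → h) (p ++ x ∷ []) u          ≡⟨ cong₂ _+_ (cong h (degree-yes act)) (slot-sum-degree h (p ++ x ∷ []) u) ⟩
      cascade (λ _ → h) (suc (degree (p ++ x ∷ []) u))                   ≡⟨ cong (cascade (λ _ → h)) (degree-yes act) ⟨
      cascade (λ _ → h) (degree p (x ∷ u))                               ∎
      where open ≡-Reasoning
    go (no ¬act) = trans (slot-sum-no {λ _ → h} ¬act)
      (trans (slot-sum-degree h (p ++ x ∷ []) u) (cong (cascade (λ _ → h)) (sym (degree-no ¬act))))

  module Closed (closed : ∀ p s {u v} → Act (p ++ s) v → Act p u) where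

    slots-none : ∀ p u → ¬ Act p [] → slots p u ≡ []
    slots-none p [] ¬act with act? p []
    ... | yes act = contradiction act ¬act
    ... | no _    = refl
    slots-none p (x ∷ u) ¬act = trans (slots-no (¬act ∘ widen))
      (cong (map (map₁ (x ∷_))) (slots-none (p ++ x ∷ []) u (¬act ∘ closed p (x ∷ []))))
      where
      widen : Act p (x ∷ u) → Act p []
      widen act = closed p [] (subst (λ s → Act s (x ∷ u)) (sym (++-identityʳ p)) act)

    -- By `closed` the slots form an unbroken run, so as many slots as letters have been skipped.
    slot-sum-length : ∀ g p u → slot-sum (g ∘ length) p u ≡ cascade g (degree p u)
    slot-sum-length g p u = go u (act? p [])
      where
      widen : ∀ {u} → Act p [] → Act p u
      widen act = closed p [] (subst (λ s → Act s []) (sym (++-identityʳ p)) act)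
      go : ∀ u → Dec (Act p []) → slot-sum (g ∘ length) p u ≡ cascade g (degree p u)
      go u (no ¬act) rewrite slots-none p u ¬act = refl
      go [] (yes act) = trans (slot-sum-[] {g ∘ length} act)
        (trans (cong (λ n → g 0 n + 0) (degree-[] act)) (cong (cascade g) (sym (degree-[] act))))
      go (x ∷ u) (yes act) = begin
        slot-sum (g ∘ length) p (x ∷ u)                                    ≡⟨ slot-sum-yes {g ∘ length} (widen act) ⟩
        g 0 (degree p (x ∷ u)) + slot-sum (g ∘ suc ∘ length) (p ++ x ∷ []) u
          ≡⟨ cong₂ _+_ (cong (g 0) (degree-yes (widen act))) (slot-sum-length (g ∘ suc) (p ++ x ∷ []) u) ⟩
        cascade g (suc (degree (p ++ x ∷ []) u))                           ≡⟨ cong (cascade g) (degree-yes (widen act)) ⟨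
        cascade g (degree p (x ∷ u))                                       ∎
        where open ≡-Reasoning

    Stop : Word → Word → Set
    Stop s []      = ⊤
    Stop s (y ∷ t) = ¬ Act (s ++ y ∷ []) []

    -- A prefix that has become inactive stays inactive, so exactly the cuts of `s`, both ends
    -- included, are slots.
    degree-run : ∀ p s t → Act (p ++ s) [] → Stop (p ++ s) t → degree p (s ++ t) ≡ suc (length s)
    degree-run p [] [] act stop = degree-[] (closed p [] act)
    degree-run p [] (y ∷ t) act stop = trans (degree-yes (closed p [] act))
      (cong (suc ∘ length) (slots-none (p ++ y ∷ []) t (subst (λ s → ¬ Act (s ++ y ∷ []) []) (++-identityʳ p) stop)))
    degree-run p (x ∷ s) t act stop = trans (degree-yes (closed p (x ∷ s) act))
      (cong suc (degree-run (p ++ x ∷ []) s t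
        (subst (λ s → Act s []) (sym (++-assoc p _ s)) act) (subst (λ s → Stop s t) (sym (++-assoc p _ s)) stop)))

-- label c i j m n is the degree of the child given by the cuts (p , q ++ r) and (p ++ q , r) of a
-- word of degree n: i and j record the lengths of p and q, and m is degree (p ++ q) r.
record Labelling (A : Pattern₃) (B : Pattern₄) : Set where
  open Pattern₃ A using (Act; act-[])
  open Slots A
  open SlotSums A
  open Tree A B
  field
    -- What a block length reveals about the index of its slot: everything if the slots form a run,
    -- only whether it is the first one for 213.
    κ        : ℕ → ℕ
    label₁   : (i m n : ℕ) → ℕ
    label    : (c i j m n : ℕ) → ℕ
    sum-κ    : ∀ g {p u} → Act p u → slot-sum (g ∘ κ ∘ length) p u ≡ cascade (g ∘ κ) (degree p u)
    degree₁  : ∀ p r → Act p r →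
               degree [] (place₁ (p , r)) ≡ label₁ (κ (length p)) (degree p r) (degree [] (p ++ r))
    degree₊  : ∀ c p q r → Act p (q ++ r) → Act (p ++ q) r →
               degree [] (place c p (q , r)) ≡
               label c (κ (length p)) (κ (length q)) (degree (p ++ q) r) (degree [] (p ++ q ++ r))

  -- A function of the degree `n` alone: by `total-insert` nothing else about the parent matters for
  -- the degrees of its children.
  step : ℕ → (ℕ → ℕ) → ℕ → ℕ
  step zero    f n = cascade (λ i m → f (label₁ (κ i) m n)) n
  step (suc c) f n = cascade (λ i m → cascade (λ j m′ → f (label c (κ i) (κ j) m′ n)) m) n

  total-insert : ∀ c f w → total (f ∘ degree []) (insert c w) ≡ step c f (degree [] w)
  total-insert zero f w = begin
    total (f ∘ degree []) (map place₁ (slots [] w))    ≡⟨ total-map (f ∘ degree []) place₁ (slots [] w) ⟩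
    total (f ∘ degree [] ∘ place₁) (slots [] w)        ≡⟨ total-cong (slots [] w) at ⟩
    slot-sum (g ∘ κ ∘ length) [] w                     ≡⟨ sum-κ g (act-[] w) ⟩
    step zero f n                                      ∎
    where
    open ≡-Reasoning
    n = degree [] w
    g : ℕ → ℕ → ℕ
    g i m = f (label₁ i m n)
    at : ∀ {s} → s ∈ slots [] w → f (degree [] (place₁ s)) ≡ weigh (g ∘ κ ∘ length) [] s
    at {p , r} s∈ with refl , act ← ∈-slots⁻ [] w s∈ = cong f (degree₁ p r act)
  total-insert (suc c) f w = begin
    total (f ∘ degree []) (concatMap (places c) (slots [] w))       ≡⟨ total-concatMap (f ∘ degree []) (places c) (slots [] w) ⟩
    total (total (f ∘ degree []) ∘ places c) (slots [] w)           ≡⟨ total-cong (slots [] w) outer ⟩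
    slot-sum (g ∘ κ ∘ length) [] w                                  ≡⟨ sum-κ g (act-[] w) ⟩
    step (suc c) f n                                                ∎
    where
    open ≡-Reasoning
    n = degree [] w
    g : ℕ → ℕ → ℕ
    g i m = cascade (λ j m′ → f (label c i (κ j) m′ n)) m
    outer : ∀ {s} → s ∈ slots [] w → total (f ∘ degree []) (places c s) ≡ weigh (g ∘ κ ∘ length) [] s
    outer {p , u} s∈ with eq , act ← ∈-slots⁻ [] w s∈ = begin
      total (f ∘ degree []) (map (place c p) (slots p u))     ≡⟨ total-map (f ∘ degree []) (place c p) (slots p u) ⟩
      total (f ∘ degree [] ∘ place c p) (slots p u)           ≡⟨ total-cong (slots p u) inner ⟩
      slot-sum (h ∘ κ ∘ length) p u                           ≡⟨ sum-κ h act ⟩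
      g (κ (length p)) (degree p u)                           ∎
      where
      h : ℕ → ℕ → ℕ
      h j m = f (label c (κ (length p)) j m n)
      inner : ∀ {t} → t ∈ slots p u → f (degree [] (place c p t)) ≡ weigh (h ∘ κ ∘ length) p t
      inner {q , r} t∈ with refl , act′ ← ∈-slots⁻ p u t∈ =
        cong f (trans (degree₊ c p q r act act′)
                      (cong (λ w → label c (κ (length p)) (κ (length q)) (degree (p ++ q) r) (degree [] w)) eq))

module _ {A B A′ B′} (L : Labelling A B) (L′ : Labelling A′ B′)
         (same-step : ∀ c f n → Labelling.step L c f n ≡ Labelling.step L′ c f n) where
  private
    module L  = Labelling L
    module L′ = Labelling L′
    module T  = Tree A B
    module T′ = Tree A′ B′
    degree  = Slots.degree A []
    degree′ = Slots.degree A′ []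

  -- The induction needs all `f` at once, since undoing the last insertion replaces `f` by
  -- `step c f`.
  total-generate : ∀ cs f → total (f ∘ degree) (T.generate cs) ≡ total (f ∘ degree′) (T′.generate cs)
  total-generate [] f = cong (λ n → f n + 0)
    (trans (SlotSums.degree-[] A (Pattern₃.act-[] A [])) (sym (SlotSums.degree-[] A′ (Pattern₃.act-[] A′ []))))
  total-generate (c ∷ cs) f = begin
    total (f ∘ degree) (concatMap (T.insert c) (T.generate cs))       ≡⟨ total-concatMap (f ∘ degree) (T.insert c) (T.generate cs) ⟩
    total (total (f ∘ degree) ∘ T.insert c) (T.generate cs)           ≡⟨ total-cong (T.generate cs) (λ {w} _ → L.total-insert c f w) ⟩
    total (L.step c f ∘ degree) (T.generate cs)                       ≡⟨ total-cong (T.generate cs) (λ {w} _ → same-step c f (degree w)) ⟩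
    total (L′.step c f ∘ degree) (T.generate cs)                      ≡⟨ total-generate cs (L′.step c f) ⟩
    total (L′.step c f ∘ degree′) (T′.generate cs)                    ≡⟨ total-cong (T′.generate cs) (λ {w} _ → L′.total-insert c f w) ⟨
    total (total (f ∘ degree′) ∘ T′.insert c) (T′.generate cs)        ≡⟨ total-concatMap (f ∘ degree′) (T′.insert c) (T′.generate cs) ⟨
    total (f ∘ degree′) (concatMap (T′.insert c) (T′.generate cs))    ∎
    where open ≡-Reasoning

  same-length : ∀ cs → length (T.generate cs) ≡ length (T′.generate cs)
  same-length cs = begin
    length (T.generate cs)              ≡⟨ length≡total (T.generate cs) ⟩
    total (λ _ → 1) (T.generate cs)     ≡⟨ total-generate cs (λ _ → 1) ⟩
    total (λ _ → 1) (T′.generate cs)    ≡⟨ length≡total (T′.generate cs) ⟨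
    length (T′.generate cs)             ∎
    where open ≡-Reasoning

-- Labellings of the three trees

0^-+ : ∀ m n → 0^ (m + n) ≡ 0^ m ++ 0^ n
0^-+ zero    n = refl
0^-+ (suc m) n = cong (0 ∷_) (0^-+ m n)

0^-∷ʳ : ∀ n → 0^ n ++ 0 ∷ [] ≡ 0^ (suc n)
0^-∷ʳ zero    = refl
0^-∷ʳ (suc n) = cong (0 ∷_) (0^-∷ʳ n)

-- s ≈ p: a cut after s in a word is active if and only if the cut after p in its reduction is.
module ZeroDegrees (P : Pattern₃)
  (_≈_ : Word → Word → Set)
  (≈-∷ʳ : ∀ s p x → s ≈ p → (s ++ suc x ∷ []) ≈ (p ++ x ∷ []))
  (≈-act : ∀ s p → s ≈ p → ∀ u → Pattern₃.Act P s (lift u) ⇔ Pattern₃.Act P p u)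
  (0^-act : ∀ n v → Pattern₃.Act P (0^ n) v) (0^≈[] : ∀ n → 0^ n ≈ [])
  where
  open Pattern₃ P using (Act; act?)
  open Slots P using (degree)
  open SlotSums P

  degree-lift : ∀ {s p} u → s ≈ p → degree s (lift u) ≡ degree p u
  degree-lift {s} {p} [] s≈p with act? p []
  ... | yes act = degree-[] (from (≈-act _ _ s≈p []) act)
  ... | no ¬act with act? s []
  ...   | yes act = contradiction (to (≈-act _ _ s≈p []) act) ¬act
  ...   | no _    = refl
  degree-lift {s} {p} (x ∷ u) s≈p = go (act? p (x ∷ u))
    where
    go : Dec (Act p (x ∷ u)) → degree s (lift (x ∷ u)) ≡ degree p (x ∷ u)
    go (yes act) = trans (degree-yes (from (≈-act _ _ s≈p (x ∷ u)) act))
      (trans (cong suc (degree-lift u (≈-∷ʳ _ _ x s≈p))) (sym (degree-yes act)))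
    go (no ¬act) = trans (degree-no (¬act ∘ to (≈-act _ _ s≈p (x ∷ u))))
      (trans (degree-lift u (≈-∷ʳ _ _ x s≈p)) (sym (degree-no ¬act)))

  degree-0^++ : ∀ n k v → degree (0^ k) (0^ n ++ v) ≡ n + degree (0^ (n + k)) v
  degree-0^++ zero    k v = refl
  degree-0^++ (suc n) k v = trans (degree-yes (0^-act k _)) (cong suc (begin
    degree (0^ k ++ 0 ∷ []) (0^ n ++ v)     ≡⟨ cong (λ s → degree s (0^ n ++ v)) (0^-∷ʳ k) ⟩
    degree (0^ (suc k)) (0^ n ++ v)         ≡⟨ degree-0^++ n (suc k) v ⟩
    n + degree (0^ (n + suc k)) v           ≡⟨ cong (λ m → n + degree (0^ m) v) (+-suc n k) ⟩
    n + degree (0^ (suc n + k)) v           ∎))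
    where open ≡-Reasoning

  degree-0^++lift : ∀ n w → degree [] (0^ n ++ lift w) ≡ n + degree [] w
  degree-0^++lift n w = trans (degree-0^++ n 0 (lift w)) (cong (n +_) (degree-lift w (0^≈[] (n + 0))))

merge-0^ : ∀ m n v → 0^ m ++ 0 ∷ 0^ n ++ v ≡ 0^ (m + suc n) ++ v
merge-0^ m n v = sym (trans (cong (_++ v) (0^-+ m (suc n))) (++-assoc (0^ m) (0^ (suc n)) v))

AllPairs-prefix : ∀ {R : ℕ → ℕ → Set} p s → AllPairs R (p ++ s) → AllPairs R p
AllPairs-prefix []      s _        = []
AllPairs-prefix (x ∷ p) s (r ∷ rs) = All.++⁻ˡ p r ∷ AllPairs-prefix p s rs

module Labelling-123 (B : Pattern₄) where
  private module B = Pattern₄ B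
  open Slots pattern-123
  open SlotSums pattern-123
  open Closed (λ p s → AllPairs-prefix p s)
  open Tree pattern-123 B

  lift-sorted : ∀ {p} → AllPairs _≤_ p → AllPairs _≤_ (lift p)
  lift-sorted = AllPairs.map⁺ ∘ AllPairs.map s≤s

  0^++-sorted : ∀ n {s} → AllPairs _≤_ s → AllPairs _≤_ (0^ n ++ s)
  0^++-sorted zero    ps = ps
  0^++-sorted (suc n) ps = All.tabulate (λ _ → z≤n) ∷ 0^++-sorted n ps

  0^++-sorted⁻ : ∀ n {s} → AllPairs _≤_ (0^ n ++ s) → AllPairs _≤_ s
  0^++-sorted⁻ zero    ps       = ps
  0^++-sorted⁻ (suc n) (_ ∷ ps) = 0^++-sorted⁻ n ps

  _≈_ : Word → Word → Set
  s ≈ p = ∃[ n ] s ≡ 0^ n ++ lift p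

  ≈-∷ʳ : ∀ s p x → s ≈ p → (s ++ suc x ∷ []) ≈ (p ++ x ∷ [])
  ≈-∷ʳ _ p x (n , refl) =
    n , trans (++-assoc (0^ n) _ _) (cong (0^ n ++_) (sym (map-++ suc p (x ∷ []))))

  ≈-act : ∀ s p → s ≈ p → Word → AllPairs _≤_ s ⇔ AllPairs _≤_ p
  ≈-act _ p (n , refl) u = mk⇔ (AllPairs.map ≤-pred ∘ AllPairs.map⁻ ∘ 0^++-sorted⁻ n)
                           (0^++-sorted n ∘ lift-sorted)

  open ZeroDegrees pattern-123 _≈_ ≈-∷ʳ ≈-act
    (λ n _ → subst (AllPairs _≤_) (++-identityʳ (0^ n)) (0^++-sorted n []))
    (λ n → n , sym (++-identityʳ (0^ n)))

  -- Leading zeros keep the prefix increasing; the first 0 after a positive letter ends the run of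
  -- slots.
  degree-until-0 : ∀ n b p t → AllPairs _≤_ (b ∷ p) →
                   degree [] (0^ n ++ lift (b ∷ p) ++ 0 ∷ t) ≡ suc (n + suc (length p))
  degree-until-0 n b p t sorted = begin
    degree [] (0^ n ++ lift (b ∷ p) ++ 0 ∷ t)      ≡⟨ cong (degree []) (++-assoc (0^ n) _ _) ⟨
    degree [] ((0^ n ++ lift (b ∷ p)) ++ 0 ∷ t)    ≡⟨ degree-run [] (0^ n ++ lift (b ∷ p)) (0 ∷ t) (0^++-sorted n (lift-sorted sorted)) stop ⟩
    suc (length (0^ n ++ lift (b ∷ p)))            ≡⟨ cong suc (length-++ (0^ n)) ⟩
    suc (length (0^ n) + length (lift (b ∷ p)))    ≡⟨ cong₂ (λ i j → suc (i + suc j)) (length-replicate n) (length-map suc p) ⟩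
    suc (n + suc (length p))                       ∎
    where
    open ≡-Reasoning
    stop : ¬ AllPairs _≤_ ((0^ n ++ lift (b ∷ p)) ++ 0 ∷ [])
    stop ps with () ← All.head (All.++⁻ʳ (lift p) (AllPairs.head
      (0^++-sorted⁻ n (subst (AllPairs _≤_) (++-assoc (0^ n) _ _) ps))))

  label₁ : (i m n : ℕ) → ℕ
  label₁ zero    m n = suc n
  label₁ (suc i) m n = suc (suc i)

  -- If both blocks are empty, all `c + 2` zeros lead and each adds a slot. Otherwise the run of
  -- slots ends at the 0 following the first nonempty block, and only the zeros before that block
  -- count.
  label : (c i j m n : ℕ) → ℕ
  label c zero    zero    m n = suc (suc (c + n))
  label c zero    (suc j) m n = suc (B.x c + suc (B.y c) + suc j)
  label c (suc i) j       m n = suc (B.x c + suc i)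

  labelling : Labelling pattern-123 B
  labelling = record
    { κ = id
    ; label₁ = label₁
    ; label = label
    ; sum-κ = λ g {p} {u} _ → slot-sum-length g p u
    ; degree₁ = degree₁
    ; degree₊ = degree₊
    }
    where
    degree₁ : ∀ p r → AllPairs _≤_ p → degree [] (place₁ (p , r)) ≡ label₁ (length p) (degree p r) (degree [] (p ++ r))
    degree₁ []      r act = degree-0^++lift 1 r
    degree₁ (b ∷ p) r act = degree-until-0 0 b p (lift r) act
    degree₊ : ∀ c p q r → AllPairs _≤_ p → AllPairs _≤_ (p ++ q) →
              degree [] (place c p (q , r)) ≡ label c (length p) (length q) (degree (p ++ q) r) (degree [] (p ++ q ++ r))
    degree₊ c [] [] r _ _ = begin
      degree [] (0^ x ++ 0 ∷ 0^ y ++ 0 ∷ 0^ z ++ lift r)    ≡⟨ cong (λ v → degree [] (0^ x ++ 0 ∷ v)) (merge-0^ y z (lift r)) ⟩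
      degree [] (0^ x ++ 0 ∷ 0^ (y + suc z) ++ lift r)      ≡⟨ cong (degree []) (merge-0^ x (y + suc z) (lift r)) ⟩
      degree [] (0^ (x + suc (y + suc z)) ++ lift r)        ≡⟨ degree-0^++lift (x + suc (y + suc z)) r ⟩
      x + suc (y + suc z) + degree [] r                     ≡⟨ cong (_+ degree [] r) count ⟩
      suc (suc (c + degree [] r))                           ∎
      where
      open ≡-Reasoning
      x = B.x c
      y = B.y c
      z = B.z c
      count : x + suc (y + suc z) ≡ suc (suc c)
      count = trans (+-suc x _) (cong suc (trans (cong (x +_) (+-suc y z)) (trans (+-suc x _) (cong suc (B.x+y+z c)))))
    degree₊ c [] (b ∷ q) r _ act = trans
      (cong (degree []) (merge-0^ (B.x c) (B.y c) _))
      (degree-until-0 (B.x c + suc (B.y c)) b q _ act)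
    degree₊ c (b ∷ p) q r act _ = degree-until-0 (B.x c) b p _ act

module Labelling-132 where
  private module B = Pattern₄ pattern-1121
  open Slots pattern-132
  open SlotSums pattern-132
  open Closed (λ p s → AllPairs-prefix p s)
  open Tree pattern-132 pattern-1121

  lift++0^-sorted : ∀ {p} n → AllPairs _≥_ p → AllPairs _≥_ (lift p ++ 0^ n)
  lift++0^-sorted n ps = AllPairs.++⁺ (AllPairs.map⁺ (AllPairs.map s≤s ps)) (constant n)
    (All.map⁺ (All.tabulate λ _ → All.replicate⁺ n z≤n))
    where
    constant : ∀ n → AllPairs _≥_ (0^ n)
    constant zero    = []
    constant (suc n) = All.replicate⁺ n z≤n ∷ constant n

  0-before-suc : ∀ p n {b} → ¬ AllPairs _≥_ ((lift p ++ 0^ (suc n)) ++ suc b ∷ [])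
  0-before-suc []      n (ps ∷ _) with () ← All.head (All.++⁻ʳ (0^ n) ps)
  0-before-suc (x ∷ p) n (_ ∷ ps) = 0-before-suc p n ps

  -- Zeros prolong a weakly decreasing prefix, so the run of slots goes on to the end of the zeros.
  degree-through-0s : ∀ p n t → AllPairs _≥_ p → Stop (lift p ++ 0^ (suc n)) t →
                      degree [] (lift p ++ 0^ (suc n) ++ t) ≡ suc (length p + suc n)
  degree-through-0s p n t sorted stop = begin
    degree [] (lift p ++ 0^ (suc n) ++ t)          ≡⟨ cong (degree []) (++-assoc (lift p) _ t) ⟨
    degree [] ((lift p ++ 0^ (suc n)) ++ t)        ≡⟨ degree-run [] (lift p ++ 0^ (suc n)) t (lift++0^-sorted (suc n) sorted) stop ⟩
    suc (length (lift p ++ 0^ (suc n)))            ≡⟨ cong suc (length-++ (lift p)) ⟩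
    suc (length (lift p) + length (0^ (suc n)))    ≡⟨ cong₂ (λ i j → suc (i + suc j)) (length-map suc p) (length-replicate n) ⟩
    suc (length p + suc n)                         ∎
    where open ≡-Reasoning

  stop-lift : ∀ p n r → Stop (lift p ++ 0^ (suc n)) (lift r)
  stop-lift p n []      = tt
  stop-lift p n (b ∷ r) = 0-before-suc p n

  label₁ : (i m n : ℕ) → ℕ
  label₁ i m n = suc (i + 1)

  -- With `q` empty all `c + 2` zeros are adjacent; otherwise `q` cuts off the last one.
  label : (c i j m n : ℕ) → ℕ
  label c i zero    m n = suc (i + suc (c + 1))
  label c i (suc j) m n = suc (i + suc c)

  labelling : Labelling pattern-132 pattern-1121
  labelling = record
    { κ = id
    ; label₁ = label₁
    ; label = label
    ; sum-κ = λ g {p} {u} _ → slot-sum-length g p u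
    ; degree₁ = λ p r act → degree-through-0s p 0 (lift r) act (stop-lift p 0 r)
    ; degree₊ = degree₊
    }
    where
    degree₊ : ∀ c p q r → AllPairs _≥_ p → AllPairs _≥_ (p ++ q) →
              degree [] (place c p (q , r)) ≡ label c (length p) (length q) (degree (p ++ q) r) (degree [] (p ++ q ++ r))
    degree₊ c p [] r act _ = trans
      (cong (λ v → degree [] (lift p ++ 0 ∷ v)) (merge-0^ c 0 (lift r)))
      (degree-through-0s p (c + 1) (lift r) act (stop-lift p (c + 1) r))
    degree₊ c p (b ∷ q) r act _ = degree-through-0s p c _ act (0-before-suc p c)

module Labelling-213 where
  open Slots pattern-213
  open SlotSums pattern-213
  open Tree pattern-213 pattern-1211

  Below-lift : ∀ s u → Below s (lift u) ⇔ Below (reduce s) u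
  Below-lift s u = mk⇔ (to′ s) (from′ s)
    where
    to′ : ∀ s → Below s (lift u) → Below (reduce s) u
    to′ []          _        = []
    to′ (zero ∷ s)  (_ ∷ bs) = to′ s bs
    to′ (suc x ∷ s) (b ∷ bs) = All.map ≤-pred (All.map⁻ b) ∷ to′ s bs
    from′ : ∀ s → Below (reduce s) u → Below s (lift u)
    from′ []          _        = []
    from′ (zero ∷ s)  bs       = All.tabulate (λ _ → z≤n) ∷ from′ s bs
    from′ (suc x ∷ s) (b ∷ bs) = All.map⁺ (All.map s≤s b) ∷ from′ s bs

  -- Zeros before a cut are below everything, so here they may stand anywhere in `s`.
  _≈_ : Word → Word → Set
  s ≈ p = reduce s ≡ p

  ≈-∷ʳ : ∀ s p x → s ≈ p → (s ++ suc x ∷ []) ≈ (p ++ x ∷ [])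
  ≈-∷ʳ s p x refl = reduce-++ s (suc x ∷ [])

  ≈-act : ∀ s p → s ≈ p → ∀ u → Below s (lift u) ⇔ Below p u
  ≈-act s p refl = Below-lift s

  open ZeroDegrees pattern-213 _≈_ ≈-∷ʳ ≈-act
    (λ n _ → All.replicate⁺ n (All.tabulate λ _ → z≤n))
    (λ n → trans (cong reduce (sym (++-identityʳ (0^ n)))) (reduce-0^++ n []))

  -- After a positive letter there is no slot before the last zero.
  degree-before-0s : ∀ {b} s t n r → suc b ∈ s →
                     degree s (t ++ 0^ (suc n) ++ lift r) ≡ degree (reduce (s ++ t)) r
  degree-before-0s {b} s t n r b∈s = go t n s b∈s
    where
    not-below : ∀ {s u} → suc b ∈ s → 0 ∈ u → ¬ Below s u
    not-below b∈s 0∈u below with () ← All.lookup (All.lookup below b∈s) 0∈u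
    go : ∀ t n s → suc b ∈ s → degree s (t ++ 0^ (suc n) ++ lift r) ≡ degree (reduce (s ++ t)) r
    go [] zero s b∈s = trans (degree-no (not-below b∈s (here refl)))
      (degree-lift r (trans (reduce-++ s (0 ∷ [])) (sym (reduce-++ s []))))
    go [] (suc n) s b∈s = trans (degree-no (not-below b∈s (here refl)))
      (trans (go [] n (s ++ 0 ∷ []) (∈-++⁺ˡ b∈s))
        (cong (λ p → degree p r) (trans (cong reduce (++-identityʳ (s ++ 0 ∷ [])))
          (trans (reduce-++ s (0 ∷ [])) (sym (reduce-++ s []))))))
    go (x ∷ t) n s b∈s = trans (degree-no (not-below b∈s (there (∈-++⁺ʳ t (here refl)))))
      (trans (go t n (s ++ x ∷ []) (∈-++⁺ˡ b∈s)) (cong (λ s → degree (reduce s) r) (++-assoc s (x ∷ []) t)))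

  sg : ℕ → ℕ
  sg zero    = 0
  sg (suc _) = 1

  -- The cut right after `p` is active, so the first slot is the one with an empty block and all
  -- later blocks are nonempty.
  sum-sg : ∀ g {p u} → Below p u → slot-sum (g ∘ sg ∘ length) p u ≡ cascade (g ∘ sg) (degree p u)
  sum-sg g {p} {[]} act = trans (slot-sum-[] {g ∘ sg ∘ length} act)
    (trans (cong (λ n → g 0 n + 0) (degree-[] act)) (cong (cascade (g ∘ sg)) (sym (degree-[] act))))
  sum-sg g {p} {x ∷ u} act = trans (slot-sum-yes {g ∘ sg ∘ length} act)
    (trans (cong₂ _+_ (cong (g 0) (degree-yes act)) (slot-sum-degree (g 1) (p ++ x ∷ []) u))
           (cong (cascade (g ∘ sg)) (sym (degree-yes act))))

  label₁ : (i m n : ℕ) → ℕ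
  label₁ zero    m n = suc n
  label₁ (suc i) m n = suc m

  -- A positive letter before a 0 destroys the cuts between them. The `m` cuts from the last 0 on
  -- survive, besides the cut at the front and, if only `p` is empty, the one after the leading 0.
  label : (c i j m n : ℕ) → ℕ
  label c zero    zero    m n = suc (suc (c + n))
  label c zero    (suc j) m n = suc (suc m)
  label c (suc i) j       m n = suc m

  labelling : Labelling pattern-213 pattern-1211
  labelling = record
    { κ = sg
    ; label₁ = label₁
    ; label = label
    ; sum-κ = sum-sg
    ; degree₁ = degree₁
    ; degree₊ = degree₊
    }
    where
    degree₁ : ∀ p r → Below p r → degree [] (place₁ (p , r)) ≡ label₁ (sg (length p)) (degree p r) (degree [] (p ++ r))
    degree₁ []      r act = degree-0^++lift 1 r
    degree₁ (b ∷ p) r act = trans (degree-yes {[]} {suc b} {lift p ++ 0 ∷ lift r} [])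
      (cong suc (trans (degree-before-0s (suc b ∷ []) (lift p) 0 r (here refl))
        (cong (λ p → degree (b ∷ p) r) (reduce-lift p))))
    degree₊ : ∀ c p q r → Below p (q ++ r) → Below (p ++ q) r →
              degree [] (place c p (q , r)) ≡
              label c (sg (length p)) (sg (length q)) (degree (p ++ q) r) (degree [] (p ++ q ++ r))
    degree₊ c [] [] r _ _ = degree-0^++lift (suc (suc c)) r
    degree₊ c [] (b ∷ q) r _ act = begin
      degree [] (0 ∷ suc b ∷ u)               ≡⟨ degree-yes {[]} {0} {suc b ∷ u} [] ⟩
      suc (degree (0 ∷ []) (suc b ∷ u))       ≡⟨ cong suc (degree-yes {0 ∷ []} {suc b} {u} ((All.tabulate λ _ → z≤n) ∷ [])) ⟩
      suc (suc (degree (0 ∷ suc b ∷ []) u))   ≡⟨ cong (suc ∘ suc) (degree-before-0s (0 ∷ suc b ∷ []) (lift q) c r (there (here refl))) ⟩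
      suc (suc (degree (b ∷ reduce (lift q)) r)) ≡⟨ cong (λ q → suc (suc (degree (b ∷ q) r))) (reduce-lift q) ⟩
      suc (suc (degree (b ∷ q) r))            ∎
      where
      open ≡-Reasoning
      u = lift q ++ 0^ (suc c) ++ lift r
    degree₊ c (b ∷ p) q r act _ = trans (degree-yes {[]} {suc b} {lift p ++ 0 ∷ lift q ++ 0^ (suc c) ++ lift r} []) (cong suc (begin
      degree (suc b ∷ []) (lift p ++ 0 ∷ lift q ++ 0^ (suc c) ++ lift r)
        ≡⟨ cong (degree (suc b ∷ [])) (++-assoc (lift p) (0 ∷ lift q) _) ⟨
      degree (suc b ∷ []) ((lift p ++ 0 ∷ lift q) ++ 0^ (suc c) ++ lift r)
        ≡⟨ degree-before-0s (suc b ∷ []) (lift p ++ 0 ∷ lift q) c r (here refl) ⟩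
      degree (b ∷ reduce (lift p ++ 0 ∷ lift q)) r
        ≡⟨ cong (λ s → degree (b ∷ s) r) (trans (reduce-lift++ p _) (cong (p ++_) (reduce-lift q))) ⟩
      degree (b ∷ p ++ q) r ∎))
      where open ≡-Reasoning

-- Equality of the two trees

∑< : ℕ → (ℕ → ℕ) → ℕ
∑< n h = cascade (λ i _ → h i) n

∑<-suc : ∀ n h → ∑< (suc n) h ≡ h n + ∑< n h
∑<-suc zero    h = refl
∑<-suc (suc n) h = begin
  h 0 + ∑< (suc n) (h ∘ suc)              ≡⟨ cong (h 0 +_) (∑<-suc n (h ∘ suc)) ⟩
  h 0 + (h (suc n) + ∑< n (h ∘ suc))      ≡⟨ exchange (h 0) (h (suc n)) _ ⟩
  h (suc n) + (h 0 + ∑< n (h ∘ suc))      ∎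
  where
  open ≡-Reasoning
  open +-*-Solver
  exchange : ∀ a b c → a + (b + c) ≡ b + (a + c)
  exchange = solve 3 (λ a b c → a :+ (b :+ c) := b :+ (a :+ c)) refl

cascade-descending : ∀ n h → cascade (λ _ m → h m) n ≡ ∑< n (h ∘ suc)
cascade-descending zero    h = refl
cascade-descending (suc n) h =
  trans (cong (h (suc n) +_) (cascade-descending n h)) (sym (∑<-suc n (h ∘ suc)))

-- Row `i` consists of `n - i` entries equal to `h i`.
triangle : (ℕ → ℕ) → ℕ → ℕ
triangle h = cascade (λ i m → ∑< m (λ _ → h i))

triangle-suc : ∀ n h → triangle h (suc n) ≡ ∑< (suc n) h + triangle h n
triangle-suc zero    h = refl
triangle-suc (suc n) h = begin
  (h 0 + k) + triangle (h ∘ suc) (suc n)                             ≡⟨ cong ((h 0 + k) +_) (triangle-suc n (h ∘ suc)) ⟩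
  (h 0 + k) + (∑< (suc n) (h ∘ suc) + triangle (h ∘ suc) n)          ≡⟨ interchange (h 0) k _ _ ⟩
  (h 0 + ∑< (suc n) (h ∘ suc)) + (k + triangle (h ∘ suc) n)          ∎
  where
  open ≡-Reasoning
  open +-*-Solver
  k = ∑< (suc n) (λ _ → h 0)
  interchange : ∀ a b c d → (a + b) + (c + d) ≡ (a + c) + (b + d)
  interchange = solve 4 (λ a b c d → (a :+ b) :+ (c :+ d) := (a :+ c) :+ (b :+ d)) refl

triangle-by-columns : ∀ n h → triangle h n ≡ cascade (λ _ m → ∑< m h) n
triangle-by-columns zero    h = refl
triangle-by-columns (suc n) h =
  trans (triangle-suc n h) (cong (∑< (suc n) h +_) (triangle-by-columns n h))

first-else : ℕ → ℕ → ℕ → ℕ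
first-else a b zero    = a
first-else a b (suc _) = b

-- On the right, row `i` is the row of the triangle with `h (suc i)` put in front; these `n + 1` new
-- entries are the separate terms on the left.
diagonal+triangle : ∀ n h → (h (suc n) + ∑< n (h ∘ suc)) + triangle h n ≡
                    cascade (λ i m → ∑< m (first-else (h (suc i)) (h i))) (suc n)
diagonal+triangle zero    h = refl
diagonal+triangle (suc n) h = begin
  (h (suc (suc n)) + (h 1 + s)) + (k + t)      ≡⟨ regroup (h (suc (suc n))) (h 1) s k t ⟩
  (h 1 + k) + ((h (suc (suc n)) + s) + t)      ≡⟨ cong ((h 1 + k) +_) (diagonal+triangle n (h ∘ suc)) ⟩
  (h 1 + k) + cascade (λ i m → ∑< m (first-else (h (suc (suc i))) (h (suc i)))) (suc n) ∎
  where
  open ≡-Reasoning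
  open +-*-Solver
  s = ∑< n (h ∘ suc ∘ suc)
  k = ∑< (suc n) (λ _ → h 0)
  t = triangle (h ∘ suc) n
  regroup : ∀ a b c d e → (a + (b + c)) + (d + e) ≡ (b + d) + ((a + c) + e)
  regroup = solve 5 (λ a b c d e → (a :+ (b :+ c)) :+ (d :+ e) := (b :+ d) :+ ((a :+ c) :+ e)) refl

-- With two or more copies let `h k = f (c + 2 + k)`. For 123 the pairs with `p` empty give
-- `h (n + 1)` and `h 1`, ..., `h n`, the others a triangle; for 132 each row starts with
-- `h (i + 1)`, for `q` empty, and goes on with `h i`.
step-123-1112≡step-132-1121 : ∀ c f n →
  Labelling.step (Labelling-123.labelling pattern-1112) c f n ≡ Labelling.step Labelling-132.labelling c f n
step-123-1112≡step-132-1121 zero    f zero    = refl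
step-123-1112≡step-132-1121 zero    f (suc n) = begin
  f (suc (suc n)) + ∑< n (f ∘ suc ∘ suc)   ≡⟨ ∑<-suc n (f ∘ suc ∘ suc) ⟨
  ∑< (suc n) (f ∘ suc ∘ suc)               ≡⟨ cascade-cong (λ i _ → cong (f ∘ suc) (+-comm 1 i)) (suc n) ⟩
  ∑< (suc n) (λ i → f (suc (i + 1)))       ∎
  where open ≡-Reasoning
step-123-1112≡step-132-1121 (suc c) f zero    = refl
step-123-1112≡step-132-1121 (suc c) f (suc n) = begin
  (h (suc n) + ∑< n (λ j → f (suc (c + 1 + suc j)))) + triangle (λ i → f (suc (c + suc i))) n
    ≡⟨ cong₂ (λ s t → (h (suc n) + s) + t)
             (cascade-cong (λ j _ → cong (f ∘ suc) (eq₁ c j)) n)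
             (cascade-cong (λ i m → cascade-cong (λ _ _ → cong (f ∘ suc) (+-suc c i)) m) n) ⟩
  (h (suc n) + ∑< n (h ∘ suc)) + triangle h n
    ≡⟨ diagonal+triangle n h ⟩
  cascade (λ i m → ∑< m (first-else (h (suc i)) (h i))) (suc n)
    ≡⟨ cascade-cong (λ i m → cascade-cong (entry i) m) (suc n) ⟩
  Labelling.step Labelling-132.labelling (suc c) f (suc n) ∎
  where
  open ≡-Reasoning
  open +-*-Solver
  h : ℕ → ℕ
  h k = f (suc (suc (c + k)))
  eq₁ : ∀ c j → c + 1 + suc j ≡ suc (c + suc j)
  eq₁ = solve 2 (λ c j → c :+ con 1 :+ (con 1 :+ j) := con 1 :+ (c :+ (con 1 :+ j))) refl
  eq₂ : ∀ c i → suc (c + suc i) ≡ i + suc (c + 1)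
  eq₂ = solve 2 (λ c i → con 1 :+ (c :+ (con 1 :+ i)) := i :+ (con 1 :+ (c :+ con 1))) refl
  eq₃ : ∀ c i → suc (c + i) ≡ i + suc c
  eq₃ = solve 2 (λ c i → con 1 :+ (c :+ i) := i :+ (con 1 :+ c)) refl
  entry : ∀ i j m → first-else (h (suc i)) (h i) j ≡ f (Labelling-132.label c i j m (suc n))
  entry i zero    m = cong (f ∘ suc) (eq₂ c i)
  entry i (suc j) m = cong (f ∘ suc) (eq₃ c i)

-- The rows with `p` empty agree up to order. In the others the degree depends on the first cut for
-- 123 and on the second for 213, so one triangle is summed by rows and by columns.
step-123-1211≡step-213-1211 : ∀ c f n →
  Labelling.step (Labelling-123.labelling pattern-1211) c f n ≡ Labelling.step Labelling-213.labelling c f n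
step-123-1211≡step-213-1211 zero    f zero    = refl
step-123-1211≡step-213-1211 zero    f (suc n) =
  cong (f (suc (suc n)) +_) (sym (cascade-descending n (f ∘ suc)))
step-123-1211≡step-213-1211 (suc c) f zero    = refl
step-123-1211≡step-213-1211 (suc c) f (suc n) = cong₂ (λ s t → (f (suc (suc (c + suc n))) + s) + t)
  (sym (cascade-descending n (f ∘ suc ∘ suc)))
  (trans (triangle-by-columns n (f ∘ suc ∘ suc))
         (cascade-cong (λ _ m → sym (cascade-descending m (f ∘ suc))) n))

good⇔avoids : ∀ {A B ρ₃ ρ₄} →
  (∀ v → Pattern₃.Av A v ⇔ Avoids (decode v) ρ₃) → (∀ v → Pattern₄.Av B v ⇔ Avoids (decode v) ρ₄) →
  ∀ v → Tree.Good A B v ⇔ AvoidsAll (ρ₃ ∷ ρ₄ ∷ []) (decode v)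
good⇔avoids av₃ av₄ v = mk⇔
  (λ (a , b) → to (av₃ v) a ∷ to (av₄ v) b ∷ [])
  (λ { (a ∷ b ∷ []) → from (av₃ v) a , from (av₄ v) b })

∼-from-labellings : ∀ {A B A′ B′ P Q} →
  (∀ v → Tree.Good A B v ⇔ AvoidsAll P (decode v)) → (∀ v → Tree.Good A′ B′ v ⇔ AvoidsAll Q (decode v)) →
  (L : Labelling A B) (L′ : Labelling A′ B′) →
  (∀ c f n → Labelling.step L c f n ≡ Labelling.step L′ c f n) → P ∼ Q
∼-from-labellings goodP goodQ L L′ same S =
  trans (av≡length-generate S _ _ _ goodP)
    (trans (same-length L L′ same (excess S)) (sym (av≡length-generate S _ _ _ goodQ)))

theorem2p18 : ((1 ∷ 2 ∷ 3 ∷ []) ∷ (1 ∷ 1 ∷ 1 ∷ 2 ∷ []) ∷ [] ∼ (1 ∷ 3 ∷ 2 ∷ []) ∷ (1 ∷ 1 ∷ 2 ∷ 1 ∷ []) ∷ [])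
    × ((1 ∷ 2 ∷ 3 ∷ []) ∷ (1 ∷ 2 ∷ 1 ∷ 1 ∷ []) ∷ [] ∼ (2 ∷ 1 ∷ 3 ∷ []) ∷ (1 ∷ 2 ∷ 1 ∷ 1 ∷ []) ∷ [])
theorem2p18 =
  ∼-from-labellings (good⇔avoids {pattern-123} {pattern-1112} av-123 av-1112)
                    (good⇔avoids {pattern-132} {pattern-1121} av-132 av-1121)
                    (Labelling-123.labelling pattern-1112) Labelling-132.labelling
                    step-123-1112≡step-132-1121 ,
  ∼-from-labellings (good⇔avoids {pattern-123} {pattern-1211} av-123 av-1211)
                    (good⇔avoids {pattern-213} {pattern-1211} av-213 av-1211)
                    (Labelling-123.labelling pattern-1211) Labelling-213.labelling
                    step-123-1211≡step-213-1211
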